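{- Let $k\ge 2$ be an integer and let $y\in(0,1]$ with $y>1/k$. Then $$\phi(1/k,y)\ge \frac{2k-3}{2k^2-4k+1}.$$
   Context: All graphs are finite, with no loops or multiple edges. $(0,1]$ is the set of reals $t$ with $0<t\le 1$. A tripartition of a graph $G$ is a partition $(A,B,C)$ of $V(G)$ into three nonempty stable (independent) sets. For $x,y\in(0,1]$, $G$ is $(x,y)$-constrained via a tripartition $(A,B,C)$ if every vertex in $A$ has at least $x|B|$ neighbours in $B$, every vertex in $B$ has at least $y|C|$ neighbours in $C$, and there are no edges between $A$ and $C$. $N^2(v)$ is the set of vertices at distance exactly two from $v$, and $N^2_A(v)=N^2(v)\cap A$. $\phi(x,y)$ is the maximum $z\in(0,1]$ (it exists) such that for every graph $G$ that is $(x,y)$-constrained via some $(A,B,C)$, there is a vertex $v\in C$ with $|N^2_A(v)|\ge z|A|$. -}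

module Defs where

import Algebra.Properties.CommutativeMonoid.Sum as Sum
open import Data.Empty using (⊥-elim)
open import Data.Fin using (Fin; zero; suc; _≟_)
open import Data.Fin.Properties using (any?)
open import Data.Fin.Subset using (Subset; Nonempty; Empty; _∈_; _∉_; _⊆_; _∩_; _∪_; ⊤; ∣_∣; inside; outside)
open import Data.Fin.Subset.Properties using (_∈?_; x∈p∩q⁺; x∈p∩q⁻; p⊆q⇒∣p∣≤∣q∣; nonempty?)
open import Data.Integer as ℤ using (+_)
open import Data.Nat as ℕ using (ℕ; zero; suc; z≤n; s≤s; NonZero)
import Data.Nat.Properties as ℕₚ
open import Data.Product using (∃-syntax; _×_; _,_; proj₁; proj₂)
open import Data.Rational as ℚ using (ℚ; 0ℚ; 1ℚ)
open import Data.Rational.Literals using (fromℤ)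
import Data.Rational.Properties as ℚₚ
import Data.Rational.Unnormalised as ℚᵘ
import Data.Rational.Unnormalised.Properties as ℚᵘₚ
import Data.Integer.Properties as ℤₚ
open import Data.Sum using (_⊎_; inj₁; inj₂)
open import Data.Vec using ([]; _∷_; lookup; tabulate; here; there)
open import Data.Vec.Properties using (lookup∘tabulate; []=⇒lookup; lookup⇒[]=)
open import Data.Bool using (true; false; if_then_else_)
open import Relation.Binary.PropositionalEquality using (_≡_; refl; sym; trans; cong; subst; subst₂)
open import Relation.Nullary using (¬_; Dec; yes; no; does; ¬?; _×-dec_)
open import Relation.Nullary.Decidable using (dec-true)

-- A real number is a Dedekind cut in the "lower set" form: a nonempty proper
-- initial segment of ℚ without a greatest element, thought of as
-- { q ∈ ℚ : q < x }.
record ℝ : Set₁ where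
  infix 4 _∋_
  field
    _∋_       : ℚ → Set
    inhabited : ∃[ q ] _∋_ q
    proper    : ∃[ q ] ¬ _∋_ q
    downward  : ∀ {p q} → p ℚ.< q → _∋_ q → _∋_ p
    rounded   : ∀ {q} → _∋_ q → ∃[ r ] (q ℚ.< r × _∋_ r)

open ℝ public

infix 4 _≤_ _<_

_≤_ : ℝ → ℝ → Set
x ≤ y = ∀ q → x ∋ q → y ∋ q

_<_ : ℝ → ℝ → Set
x < y = ∃[ q ] (y ∋ q × ¬ (x ∋ q))

decrease : ∀ p → ∃[ q ] q ℚ.< p
decrease p = p ℚ.+ ℚ.- 1ℚ ,
  subst (p ℚ.+ ℚ.- 1ℚ ℚ.<_) (ℚₚ.+-identityʳ p)
    (ℚₚ.+-monoʳ-< p (ℚₚ.negative⁻¹ (ℚ.- 1ℚ)))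

fromℚ : ℚ → ℝ
fromℚ p = record
  { _∋_       = ℚ._< p
  ; inhabited = decrease p
  ; proper    = p , ℚₚ.<-irrefl refl
  ; downward  = ℚₚ.<-trans
  ; rounded   = λ q<p → let (r , q<r , r<p) = ℚₚ.<-dense q<p in r , q<r , r<p
  }

ℕ→ℚ : ℕ → ℚ
ℕ→ℚ n = fromℤ (+ n)

fromℕ : ℕ → ℝ
fromℕ n = fromℚ (ℕ→ℚ n)

∌⇒≥ : ∀ x {r u} → x ∋ r → ¬ (x ∋ u) → r ℚ.≤ u
∌⇒≥ x r∈ u∉ = ℚₚ.≮⇒≥ (λ u<r → u∉ (downward x u<r r∈))

instance
  ℕ→ℚ-nonNeg : ∀ {n} → ℚ.NonNegative (ℕ→ℚ n)
  ℕ→ℚ-nonNeg = _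

infixl 7 _·_

-- Multiplication of a real by a natural number.  For n > 0 the cut below is
-- { r * n : r < x }; for n = 0 it is { q : q < 0 }.
_·_ : ℝ → ℕ → ℝ
x · n = record
  { _∋_       = λ q → ∃[ r ] (x ∋ r × q ℚ.< r ℚ.* ℕ→ℚ n)
  ; inhabited = let (r , r∈) = inhabited x
                    (q , q<) = decrease (r ℚ.* ℕ→ℚ n)
                in q , r , r∈ , q<
  ; proper    = let (u , u∉) = proper x in
      u ℚ.* ℕ→ℚ n , λ (r , r∈ , un<rn) → ℚₚ.<-irrefl refl
        (ℚₚ.<-≤-trans un<rn (ℚₚ.*-monoʳ-≤-nonNeg (ℕ→ℚ n) (∌⇒≥ x r∈ u∉)))
  ; downward  = λ p<q (r , r∈ , q<) → r , r∈ , ℚₚ.<-trans p<q q<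
  ; rounded   = λ (r , r∈ , q<) → let (s , q<s , s<) = ℚₚ.<-dense q< in
      s , q<s , r , r∈ , s<
  }

-- The interval (0,1].
InUnit : ℝ → Set
InUnit z = fromℚ 0ℚ < z × z ≤ fromℚ 1ℚ

IsMaximum : (ℝ → Set) → ℝ → Set₁
IsMaximum P m = P m × (∀ z → P z → z ≤ m)

-- Simple graphs on the vertex set Fin order, given by the neighbourhoods N v.
record Graph : Set where
  field
    order       : ℕ
    N           : Fin order → Subset order
    symmetric   : ∀ {u v} → u ∈ N v → v ∈ N u
    irreflexive : ∀ {v} → v ∉ N v

  Vertex : Set
  Vertex = Fin order

  Stable : Subset order → Set
  Stable S = ∀ {u v} → u ∈ S → v ∈ S → u ∉ N v

  Walk : ℕ → Vertex → Vertex → Set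
  Walk zero    u v = u ≡ v
  Walk (suc ℓ) u v = ∃[ w ] (w ∈ N u × Walk ℓ w v)

  AtDistance : ℕ → Vertex → Vertex → Set
  AtDistance d u v = Walk d u v × (∀ {ℓ} → ℓ ℕ.< d → ¬ Walk ℓ u v)

  walk? : ∀ ℓ u v → Dec (Walk ℓ u v)
  walk? zero    u v = u ≟ v
  walk? (suc ℓ) u v = any? (λ w → (w ∈? N u) ×-dec walk? ℓ w v)

  atDistance? : ∀ d u v → Dec (AtDistance d u v)
  atDistance? d u v =
    walk? d u v ×-dec ℕₚ.allUpTo? (λ ℓ → ¬? (walk? ℓ u v)) d

  N² : Vertex → Subset order
  N² v = tabulate (λ u → does (atDistance? 2 v u))

record Tripartition (G : Graph) : Set where
  open Graph G
  field
    A B C       : Subset order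
    A-nonempty  : Nonempty A
    B-nonempty  : Nonempty B
    C-nonempty  : Nonempty C
    A-stable    : Stable A
    B-stable    : Stable B
    C-stable    : Stable C
    A∩B-empty   : Empty (A ∩ B)
    A∩C-empty   : Empty (A ∩ C)
    B∩C-empty   : Empty (B ∩ C)
    covering    : A ∪ B ∪ C ≡ ⊤

  N²A : Vertex → Subset order
  N²A v = N² v ∩ A

record Constrained (x y : ℝ) (G : Graph) (T : Tripartition G) : Set where
  open Graph G
  open Tripartition T
  field
    A-to-B : ∀ {a} → a ∈ A → x · ∣ B ∣ ≤ fromℕ ∣ N a ∩ B ∣
    B-to-C : ∀ {b} → b ∈ B → y · ∣ C ∣ ≤ fromℕ ∣ N b ∩ C ∣
    A-to-C : ∀ {a c} → a ∈ A → c ∈ C → c ∉ N a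

-- The set of z ∈ (0,1] whose maximum is φ(x,y).
Admissible : ℝ → ℝ → ℝ → Set
Admissible x y z = InUnit z ×
  (∀ (G : Graph) (T : Tripartition G) → Constrained x y G T →
    ∃[ v ] (v ∈ Tripartition.C T ×
            z · ∣ Tripartition.A T ∣ ≤ fromℕ ∣ Tripartition.N²A T v ∣))

≤ᴿ-trans : ∀ x y z → x ≤ y → y ≤ z → x ≤ z
≤ᴿ-trans x y z p q r r∈ = q r (p r r∈)

·-mono : ∀ x y n → x ≤ y → x · n ≤ y · n
·-mono x y n x≤y q (r , r∈ , q<) = r , x≤y r r∈ , q<

∋⇒fromℚ≤ : ∀ x q → x ∋ q → fromℚ q ≤ x
∋⇒fromℚ≤ x q q∈ p p<q = downward x p<q q∈

admissible-below : ∀ x y z q → Admissible x y z → z ∋ q → 0ℚ ℚ.< q →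
                   Admissible x y (fromℚ q)
admissible-below x y z q ((_ , z≤1) , f) q∈ 0<q =
  ((0ℚ , 0<q , ℚₚ.<-irrefl refl) ,
    ≤ᴿ-trans (fromℚ q) z (fromℚ 1ℚ) q≤z z≤1) ,
  λ G T K → let (v , v∈C , h) = f G T K
                a = ∣ Tripartition.A T ∣ in
    v , v∈C ,
    ≤ᴿ-trans (fromℚ q · a) (z · a) (fromℕ _) (·-mono (fromℚ q) z a q≤z) h
  where q≤z = ∋⇒fromℚ≤ z q q∈

-- The cut is the supremum of the admissible rationals; `φ-isMaximum` shows that
-- for x, y ∈ (0,1] it is the maximum of all admissible reals.  The
-- disjunct q < 0 only serves to make φ x y a cut for all x and y.
φ : ℝ → ℝ → ℝ
φ x y = record
  { _∋_       = λ q → q ℚ.< 0ℚ ⊎ ∃[ z ] (q ℚ.< z × Admissible x y (fromℚ z))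
  ; inhabited = let (q , q<0) = decrease 0ℚ in q , inj₁ q<0
  ; proper    = 1ℚ , λ
      { (inj₁ 1<0) → ℚₚ.<-asym (ℚₚ.positive⁻¹ 1ℚ) 1<0
      ; (inj₂ (z , 1<z , ((_ , z≤1) , _))) → ℚₚ.<-irrefl refl (z≤1 1ℚ 1<z) }
  ; downward  = λ
      { p<q (inj₁ q<0)             → inj₁ (ℚₚ.<-trans p<q q<0)
      ; p<q (inj₂ (z , q<z , adm)) → inj₂ (z , ℚₚ.<-trans p<q q<z , adm) }
  ; rounded   = λ
      { (inj₁ q<0) → let (r , q<r , r<0) = ℚₚ.<-dense q<0 in
                     r , q<r , inj₁ r<0
      ; (inj₂ (z , q<z , adm)) → let (r , q<r , r<z) = ℚₚ.<-dense q<z in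
                                 r , q<r , inj₂ (z , r<z , adm) }
  }

module Σℕ = Sum ℕₚ.+-0-commutativeMonoid
open Σℕ using (sum; ∑-comm; sum-cong-≗; sum-replicate-zero)

best : ∀ {n} (_≼_ : ℕ → ℕ → Set) →
       (∀ i → i ≼ i) → (∀ {i j k} → i ≼ j → j ≼ k → i ≼ k) →
       (∀ i j → i ≼ j ⊎ j ≼ i) →
       (S : Subset n) (f : Fin n → ℕ) → Nonempty S →
       ∃[ v ] (v ∈ S × (∀ w → w ∈ S → f w ≼ f v))
best _≼_ rf tr to (outside ∷ S) f (suc w , there w∈) =
  let (v , v∈ , h) = best _≼_ rf tr to S (λ i → f (suc i)) (w , w∈) in
  suc v , there v∈ , λ { (suc u) (there u∈) → h u u∈ }
best _≼_ rf tr to (inside ∷ S) f _ with nonempty? S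
... | no  ∅ = zero , here , λ
      { zero    here       → rf _
      ; (suc u) (there u∈) → ⊥-elim (∅ (u , u∈)) }
... | yes ne with best _≼_ rf tr to S (λ i → f (suc i)) ne
... | v , v∈ , h with to (f zero) (f (suc v))
... | inj₁ 0≼v = suc v , there v∈ , λ
      { zero    here       → 0≼v
      ; (suc u) (there u∈) → h u u∈ }
... | inj₂ v≼0 = zero , here , λ
      { zero    here       → rf _
      ; (suc u) (there u∈) → tr (h u u∈) v≼0 }

max-on : ∀ {n} (S : Subset n) (f : Fin n → ℕ) → Nonempty S →
         ∃[ v ] (v ∈ S × (∀ w → w ∈ S → f w ℕ.≤ f v))
max-on = best ℕ._≤_ (λ _ → ℕₚ.≤-refl) ℕₚ.≤-trans ℕₚ.≤-total

min-on : ∀ {n} (S : Subset n) (f : Fin n → ℕ) → Nonempty S →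
         ∃[ v ] (v ∈ S × (∀ w → w ∈ S → f v ℕ.≤ f w))
min-on = best ℕ._≥_ (λ _ → ℕₚ.≤-refl) (λ p q → ℕₚ.≤-trans q p)
              (λ i j → ℕₚ.≤-total j i)

when : ∀ {n} → Subset n → (Fin n → ℕ) → Fin n → ℕ
when S f i = if lookup S i then f i else 0

∣∣-sum : ∀ {n} (S : Subset n) → ∣ S ∣ ≡ sum (when S (λ _ → 1))
∣∣-sum []            = refl
∣∣-sum (inside  ∷ S) = cong suc (∣∣-sum S)
∣∣-sum (outside ∷ S) = ∣∣-sum S

sum-lower : ∀ {n} (S : Subset n) f d → (∀ i → i ∈ S → d ℕ.≤ f i) →
            ∣ S ∣ ℕ.* d ℕ.≤ sum (when S f)
sum-lower []            f d h = z≤n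
sum-lower (inside  ∷ S) f d h = ℕₚ.+-mono-≤ (h zero here)
  (sum-lower S (λ i → f (suc i)) d (λ i i∈ → h (suc i) (there i∈)))
sum-lower (outside ∷ S) f d h =
  sum-lower S (λ i → f (suc i)) d (λ i i∈ → h (suc i) (there i∈))

sum-upper : ∀ {n} (S : Subset n) f d → (∀ i → i ∈ S → f i ℕ.≤ d) →
            sum (when S f) ℕ.≤ ∣ S ∣ ℕ.* d
sum-upper []            f d h = z≤n
sum-upper (inside  ∷ S) f d h = ℕₚ.+-mono-≤ (h zero here)
  (sum-upper S (λ i → f (suc i)) d (λ i i∈ → h (suc i) (there i∈)))
sum-upper (outside ∷ S) f d h =
  sum-upper S (λ i → f (suc i)) d (λ i i∈ → h (suc i) (there i∈))

when-sum : ∀ {m n} (S : Subset m) (g : Fin m → Fin n → ℕ) i →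
           when S (λ i → sum (g i)) i ≡ sum (λ j → when S (λ i → g i j) i)
when-sum {n = n} S g i with lookup S i
... | true  = refl
... | false = sym (sum-replicate-zero n)

when-lookup : ∀ {n} (S R : Subset n) i →
              when (R ∩ S) (λ _ → 1) i ≡ when S (when R (λ _ → 1)) i
when-lookup (s     ∷ S) (r     ∷ R) (suc i) = when-lookup S R i
when-lookup (true  ∷ S) (true  ∷ R) zero    = refl
when-lookup (false ∷ S) (true  ∷ R) zero    = refl
when-lookup (true  ∷ S) (false ∷ R) zero    = refl
when-lookup (false ∷ S) (false ∷ R) zero    = refl

when-swap : ∀ {n} (S T : Subset n) (f : Fin n → Fin n → ℕ) i j →
            when S (λ i → when T (λ j → f i j) j) i ≡
            when T (λ j → when S (λ i → f i j) i) j
when-swap S T f i j with lookup S i | lookup T j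
... | true  | true  = refl
... | true  | false = refl
... | false | true  = refl
... | false | false = refl

-- Double counting for the relation R and its transpose.
double-count : ∀ {n} (S T : Subset n) (R R′ : Fin n → Subset n) →
               (∀ i j → lookup (R i) j ≡ lookup (R′ j) i) → ∀ d m →
               (∀ i → i ∈ S → d ℕ.≤ ∣ R i ∩ T ∣) →
               (∀ j → j ∈ T → ∣ R′ j ∩ S ∣ ℕ.≤ m) →
               ∣ S ∣ ℕ.* d ℕ.≤ ∣ T ∣ ℕ.* m
double-count S T R R′ tr d m lo hi = ℕₚ.≤-trans (sum-lower S _ d lo)
  (ℕₚ.≤-trans (ℕₚ.≤-reflexive eq) (sum-upper T _ m hi))
  where
  g : Fin _ → Fin _ → ℕ
  g i j = when (R i) (λ _ → 1) j
  g′ : Fin _ → Fin _ → ℕ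
  g′ j i = when (R′ j) (λ _ → 1) i
  gg′ : ∀ i j → g i j ≡ g′ j i
  gg′ i j with lookup (R i) j | lookup (R′ j) i | tr i j
  ... | true  | _ | refl = refl
  ... | false | _ | refl = refl
  when-cong : ∀ {n} (S : Subset n) {f f′ : Fin n → ℕ} → (∀ i → f i ≡ f′ i) →
              ∀ i → when S f i ≡ when S f′ i
  when-cong S h i with lookup S i
  ... | true  = h i
  ... | false = refl
  expand : ∀ {n} (R S : Subset n) → ∣ R ∩ S ∣ ≡ sum (when S (when R (λ _ → 1)))
  expand R S = trans (∣∣-sum (R ∩ S)) (sum-cong-≗ (when-lookup S R))
  eq : sum (when S (λ i → ∣ R i ∩ T ∣)) ≡ sum (when T (λ j → ∣ R′ j ∩ S ∣))
  eq = trans (sum-cong-≗ (λ i → trans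
               (when-cong S (λ i → expand (R i) T) i)
               (when-sum S (λ i → when T (g i)) i)))
      (trans (∑-comm (λ i j → when S (λ i → when T (g i) j) i))
      (sum-cong-≗ (λ j → trans
        (sum-cong-≗ (λ i → trans (when-swap S T g i j)
          (when-cong T (λ j → when-cong S (λ i → gg′ i j) i) j)))
        (sym (trans
          (when-cong T (λ j → expand (R′ j) S) j)
          (when-sum T (λ j → when S (g′ j)) j))))))

ℕ→ℚ-mono : ∀ {m n} → m ℕ.≤ n → ℕ→ℚ m ℚ.≤ ℕ→ℚ n
ℕ→ℚ-mono m≤n = ℚ.*≤* (ℤₚ.*-monoʳ-≤-nonNeg (+ 1) (ℤ.+≤+ m≤n))

ℕ→ℚ-* : ∀ m n → ℕ→ℚ (m ℕ.* n) ≡ ℕ→ℚ m ℚ.* ℕ→ℚ n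
ℕ→ℚ-* m n = ℚₚ.toℚᵘ-injective (ℚᵘₚ.≃-trans
  (ℚᵘ.*≡* (cong (ℤ._* + 1) (ℤₚ.pos-* m n)))
  (ℚᵘₚ.≃-sym (ℚₚ.toℚᵘ-homo-* (ℕ→ℚ m) (ℕ→ℚ n))))

fromℕ-mono : ∀ {m n} → m ℕ.≤ n → fromℕ m ≤ fromℕ n
fromℕ-mono m≤n q q<m = ℚₚ.<-≤-trans q<m (ℕ→ℚ-mono m≤n)

·≤⇒*≤ : ∀ x q m n → x ∋ q → x · m ≤ fromℕ n → q ℚ.* ℕ→ℚ m ℚ.≤ ℕ→ℚ n
·≤⇒*≤ x q m n q∈ h =
  ℚₚ.≮⇒≥ (λ n<qm → ℚₚ.<-irrefl refl (h _ (q , q∈ , n<qm)))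

*≤⇒·≤ : ∀ q m n → q ℚ.* ℕ→ℚ m ℚ.≤ ℕ→ℚ n → fromℚ q · m ≤ fromℕ n
*≤⇒·≤ q m n h s (r , r<q , s<rm) = ℚₚ.<-≤-trans s<rm
  (ℚₚ.≤-trans (ℚₚ.*-monoʳ-≤-nonNeg (ℕ→ℚ m) (ℚₚ.<⇒≤ r<q)) h)

nonempty⇒size : ∀ {n} {S : Subset n} → Nonempty S → NonZero ∣ S ∣
nonempty⇒size {S = inside  ∷ S} _                   = _
nonempty⇒size {S = outside ∷ S} (suc i , there i∈) = nonempty⇒size (i , i∈)

size⇒nonempty : ∀ {n} (S : Subset n) → 0 ℕ.< ∣ S ∣ → Nonempty S
size⇒nonempty (inside  ∷ S) _ = zero , here
size⇒nonempty (outside ∷ S) p =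
  let (i , i∈) = size⇒nonempty S p in suc i , there i∈

average : ∀ q a c d m .{{_ : NonZero c}} → a ℕ.* d ℕ.≤ c ℕ.* m →
          q ℚ.* ℕ→ℚ c ℚ.≤ ℕ→ℚ d → q ℚ.* ℕ→ℚ a ℚ.≤ ℕ→ℚ m
average q a c@(suc _) d m ad≤cm qc≤d = ℚₚ.*-cancelʳ-≤-pos (ℕ→ℚ c) (begin
  (q ℚ.* ℕ→ℚ a) ℚ.* ℕ→ℚ c   ≡⟨ ℚₚ.*-assoc q _ _ ⟩
  q ℚ.* (ℕ→ℚ a ℚ.* ℕ→ℚ c)   ≡⟨ cong (q ℚ.*_) (ℚₚ.*-comm (ℕ→ℚ a) (ℕ→ℚ c)) ⟩
  q ℚ.* (ℕ→ℚ c ℚ.* ℕ→ℚ a)   ≡⟨ sym (ℚₚ.*-assoc q _ _) ⟩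
  (q ℚ.* ℕ→ℚ c) ℚ.* ℕ→ℚ a   ≤⟨ ℚₚ.*-monoʳ-≤-nonNeg (ℕ→ℚ a) qc≤d ⟩
  ℕ→ℚ d ℚ.* ℕ→ℚ a           ≡⟨ sym (ℕ→ℚ-* d a) ⟩
  ℕ→ℚ (d ℕ.* a)             ≤⟨ ℕ→ℚ-mono (subst₂ ℕ._≤_ (ℕₚ.*-comm a d) (ℕₚ.*-comm c m) ad≤cm) ⟩
  ℕ→ℚ (m ℕ.* c)             ≡⟨ ℕ→ℚ-* m c ⟩
  ℕ→ℚ m ℚ.* ℕ→ℚ c           ∎)
  where
  open ℚₚ.≤-Reasoning

-- Every a ∈ A has a neighbour b ∈ B, so it lies in N²(v) for all the at
-- least q|C| vertices v ∈ N(b) ∩ C.  Now average over v ∈ C.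
module Average (x y : ℝ) (x>0 : fromℚ 0ℚ < x) (q : ℚ) (q∈y : y ∋ q)
               (G : Graph) (T : Tripartition G) (K : Constrained x y G T) where
  open Graph G
  open Tripartition T
  open Constrained K

  some-neighbour : ∀ {a} → a ∈ A → Nonempty (N a ∩ B)
  some-neighbour {a} a∈A with ∣ N a ∩ B ∣ in eq
  ... | suc _ = size⇒nonempty (N a ∩ B) (subst (0 ℕ.<_) (sym eq) (s≤s z≤n))
  ... | zero  = ⊥-elim (ℚₚ.<-irrefl refl (x·B≤0 0ℚ (r , r∈x , 0<rB)))
    where
    x·B≤0 : x · ∣ B ∣ ≤ fromℕ 0
    x·B≤0 = subst (λ n → x · ∣ B ∣ ≤ fromℕ n) eq (A-to-B a∈A)
    r = proj₁ (rounded x (proj₁ (proj₂ x>0)))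
    r∈x = proj₂ (proj₂ (rounded x (proj₁ (proj₂ x>0))))
    0<r : 0ℚ ℚ.< r
    0<r = ℚₚ.≤-<-trans (ℚₚ.≮⇒≥ (proj₂ (proj₂ x>0)))
                        (proj₁ (proj₂ (rounded x (proj₁ (proj₂ x>0)))))
    0<rB : 0ℚ ℚ.< r ℚ.* ℕ→ℚ ∣ B ∣
    0<rB with ∣ B ∣ | nonempty⇒size B-nonempty
    ... | b@(suc _) | _ = subst (ℚ._< r ℚ.* ℕ→ℚ b) (ℚₚ.*-zeroˡ (ℕ→ℚ b))
                            (ℚₚ.*-monoˡ-<-pos (ℕ→ℚ b) 0<r)

  R : Vertex → Subset order
  R a = tabulate (λ v → lookup (N² v) a)

  distance-two : ∀ {a b v} → a ∈ A → b ∈ N a → v ∈ N b → v ∈ C →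
                 AtDistance 2 v a
  distance-two {a} {b} {v} a∈A b∈Na v∈Nb v∈C =
    (b , symmetric v∈Nb , a , symmetric b∈Na , refl) , short
    where
    short : ∀ {ℓ} → ℓ ℕ.< 2 → ¬ Walk ℓ v a
    short {0} _ refl = A∩C-empty (a , x∈p∩q⁺ (a∈A , v∈C))
    short {1} _ (_ , a∈Nv , refl) = A-to-C a∈A v∈C (symmetric a∈Nv)
    short {suc (suc _)} (s≤s (s≤s ()))

  d : Vertex → ℕ
  d a = ∣ R a ∩ C ∣

  d-large : ∀ {a} → a ∈ A → q ℚ.* ℕ→ℚ ∣ C ∣ ℚ.≤ ℕ→ℚ (d a)
  d-large {a} a∈A = ℚₚ.≤-trans
    (·≤⇒*≤ y q (∣ C ∣) (∣ N b ∩ C ∣) q∈y (B-to-C (proj₂ b∈)))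
    (ℕ→ℚ-mono (p⊆q⇒∣p∣≤∣q∣ sub))
    where
    b = proj₁ (some-neighbour a∈A)
    b∈ = x∈p∩q⁻ (N a) B (proj₂ (some-neighbour a∈A))
    sub : N b ∩ C ⊆ R a ∩ C
    sub {v} v∈ = let (v∈Nb , v∈C) = x∈p∩q⁻ (N b) C v∈ in
      x∈p∩q⁺ (lookup⇒[]= v (R a)
        (trans (lookup∘tabulate (λ v → lookup (N² v) a) v)
        (trans (lookup∘tabulate (λ u → does (atDistance? 2 v u)) a)
        (dec-true (atDistance? 2 v a)
          (distance-two a∈A (proj₁ b∈) v∈Nb v∈C)))) , v∈C)

  result : ∃[ v ] (v ∈ C × fromℚ q · ∣ A ∣ ≤ fromℕ ∣ N² v ∩ A ∣)
  result =
    let (v , v∈C , v-max) = max-on C (λ v → ∣ N² v ∩ A ∣) C-nonempty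
        (a , a∈A , a-min) = min-on A d A-nonempty
    in v , v∈C , *≤⇒·≤ q (∣ A ∣) (∣ N² v ∩ A ∣)
         (average q (∣ A ∣) (∣ C ∣) (d a) (∣ N² v ∩ A ∣)
           {{nonempty⇒size C-nonempty}}
           (double-count A C R N²
             (λ a v → lookup∘tabulate (λ v → lookup (N² v) a) v)
             (d a) (∣ N² v ∩ A ∣) a-min v-max)
           (d-large a∈A))

φ-isMaximum : ∀ x y → InUnit x → InUnit y → IsMaximum (Admissible x y) (φ x y)
φ-isMaximum x y (x>0 , _) ((q , q∈y , q≮0) , y≤1) =
  ((φ>0 , φ≤1) , attained) , upper
  where
  φ>0 : fromℚ 0ℚ < φ x y
  φ>0 = let (r , q<r , r∈y) = rounded y q∈y
            0<r = ℚₚ.≤-<-trans (ℚₚ.≮⇒≥ q≮0) q<r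
        in q , inj₂ (r , q<r ,
             ((0ℚ , 0<r , ℚₚ.<-irrefl refl) ,
              ≤ᴿ-trans (fromℚ r) y (fromℚ 1ℚ) (∋⇒fromℚ≤ y r r∈y) y≤1) ,
             Average.result x y x>0 r r∈y) , q≮0

  φ≤1 : φ x y ≤ fromℚ 1ℚ
  φ≤1 s (inj₁ s<0) = ℚₚ.<-trans s<0 (ℚₚ.positive⁻¹ 1ℚ)
  φ≤1 s (inj₂ (z , s<z , ((_ , z≤1) , _))) = z≤1 s s<z

  attained : ∀ (G : Graph) (T : Tripartition G) → Constrained x y G T →
    ∃[ v ] (v ∈ Tripartition.C T ×
            φ x y · ∣ Tripartition.A T ∣ ≤ fromℕ ∣ Tripartition.N²A T v ∣)
  attained G T K = v , v∈C , bound
    where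
    open Graph G
    open Tripartition T
    best-v = max-on C (λ v → ∣ N² v ∩ A ∣) C-nonempty
    v = proj₁ best-v
    v∈C = proj₁ (proj₂ best-v)
    bound : φ x y · ∣ A ∣ ≤ fromℕ ∣ N² v ∩ A ∣
    bound s (r , inj₁ r<0 , s<rA) = ℚₚ.<-≤-trans s<rA
      (ℚₚ.≤-trans (ℚₚ.*-monoʳ-≤-nonNeg (ℕ→ℚ ∣ A ∣) (ℚₚ.<⇒≤ r<0))
      (ℚₚ.≤-trans (ℚₚ.≤-reflexive (ℚₚ.*-zeroˡ (ℕ→ℚ ∣ A ∣)))
                  (ℕ→ℚ-mono {0} z≤n)))
    bound s (r , inj₂ (z , r<z , (_ , f)) , s<rA) =
      let (w , w∈C , h) = f G T K in
      fromℕ-mono (proj₂ (proj₂ best-v) w w∈C) s (h s (r , r<z , s<rA))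

  upper : ∀ z → Admissible x y z → z ≤ φ x y
  upper z adm s s∈z with s ℚ.<? 0ℚ
  ... | yes s<0 = inj₁ s<0
  ... | no  s≮0 = let (r , s<r , r∈z) = rounded z s∈z in
    inj₂ (r , s<r ,
      admissible-below x y z r adm r∈z (ℚₚ.≤-<-trans (ℚₚ.≮⇒≥ s≮0) s<r))

{-# OPTIONS --safe #-}

-- Write k = r + 2, and call b, b′ ∈ B linked if they have a common neighbour
-- c ∈ C.  Then N(b) ∩ A and N(b′) ∩ A both lie in N²(c) ∩ A, so their union has
-- size at most M = max |N²(c) ∩ A|.  Among any k vertices of B two are linked,
-- since each has more than |C|/k neighbours in C.  Trim the neighbourhoods in B
-- of the vertices of A to a common size n ≥ |B|/k.  As in the greedy proof of
-- Turán's theorem, repeatedly pick b among the remaining vertices R ⊆ B and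
-- delete the star D of all vertices of R linked to b; this stops after at most
-- k - 1 steps.  Averaging over b ∈ R shows that b can be picked such that
-- (2k - 3) e(A,D) ≤ cost(|D|) M.  The costs add up to at most (2k² - 4k + 1) n
-- if k ≥ 3, whereas the numbers e(A,D) add up to n |A|.  For k = 2 a vertex
-- of C adjacent to more than half of B reaches all of A.

module Submission where

import Algebra.Properties.CommutativeSemigroup as CommutativeSemigroupProperties
import Algebra.Properties.Semiring.Sum as SemiringSum
open import Data.Bool using (true; false)
open import Data.Empty using (⊥-elim)
open import Data.Fin using (Fin; zero; suc)
open import Data.Fin.Subset using (Subset; Nonempty; Empty; _∈_; _∉_; _⊆_; _∩_; _∪_; _─_; ⊥; ∣_∣; inside; outside)
open import Data.Fin.Subset.Properties
open import Data.Integer using (+_; _⊖_)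
import Data.Integer as ℤ
import Data.Integer.Properties as ℤₚ
open import Data.List using ([]; _∷_; map; length)
open import Data.Nat using (ℕ; suc; NonZero; _*_; _∸_; _^_) renaming (_≤_ to _≤ℕ_)
open import Data.Nat using (zero; _+_; _⊓_; _⊔_; z≤n; s≤s; _<?_; >-nonZero) renaming (_<_ to _<ℕ_)
open import Data.Nat.ListAction using () renaming (sum to sumᴸ)
import Data.Nat.Properties as ℕₚ
open import Data.Nat.Tactic.RingSolver using (solve-∀)
open import Data.Product using (∃-syntax; _×_; _,_; proj₁; proj₂)
open import Data.Rational using (_/_; 0ℚ; 1ℚ)
import Data.Rational as ℚ
import Data.Rational.Properties as ℚₚ
import Data.Rational.Unnormalised as ℚᵘ
import Data.Rational.Unnormalised.Properties as ℚᵘₚ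
open import Data.Sum using (_⊎_; inj₁; inj₂)
open import Data.Vec using ([]; _∷_; lookup; tabulate; here; there)
open import Data.Vec.Properties using (lookup∘tabulate; []=⇒lookup; lookup⇒[]=)
open import Function using (_∘_; case_of_)
open import Relation.Binary.PropositionalEquality using (_≡_; refl; sym; trans; cong; cong₂; subst; subst₂; module ≡-Reasoning)
open import Relation.Nullary using (¬_; yes; no; does)
open import Relation.Nullary.Decidable using (dec-true)
open import Defs

open SemiringSum ℕₚ.+-*-semiring using (sum; ∑-comm; ∑-distrib-+; sum-cong-≗; *-distribˡ-sum)
open CommutativeSemigroupProperties ℕₚ.*-commutativeSemigroup using (x∙yz≈y∙xz)

-- Sums over subsets

χ : ∀ {p} → Subset p → Fin p → ℕ
χ S = when S (λ _ → 1)

sum-mono : ∀ {p} {f g : Fin p → ℕ} → (∀ i → f i ≤ℕ g i) → sum f ≤ℕ sum g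
sum-mono {zero}  h = z≤n
sum-mono {suc p} h = ℕₚ.+-mono-≤ (h zero) (sum-mono (λ i → h (suc i)))

χ-∩ : ∀ {p} (S R : Subset p) i → χ (S ∩ R) i ≡ χ S i * χ R i
χ-∩ (true  ∷ S) (r ∷ R) zero    = sym (ℕₚ.+-identityʳ _)
χ-∩ (false ∷ S) (r ∷ R) zero    = refl
χ-∩ (s ∷ S)     (r ∷ R) (suc i) = χ-∩ S R i

χ-split : ∀ {p} (S R : Subset p) i → χ (S ∩ R) i + χ (S ─ R) i ≡ χ S i
χ-split (true  ∷ S) (true  ∷ R) zero    = refl
χ-split (true  ∷ S) (false ∷ R) zero    = refl
χ-split (false ∷ S) (true  ∷ R) zero    = refl
χ-split (false ∷ S) (false ∷ R) zero    = refl
χ-split (s ∷ S)     (r ∷ R)     (suc i) = χ-split S R i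

∣∩∣+∣─∣ : ∀ {p} (S R : Subset p) → ∣ S ∩ R ∣ + ∣ S ─ R ∣ ≡ ∣ S ∣
∣∩∣+∣─∣ S R = begin
  ∣ S ∩ R ∣ + ∣ S ─ R ∣                    ≡⟨ cong₂ _+_ (∣∣-sum (S ∩ R)) (∣∣-sum (S ─ R)) ⟩
  sum (χ (S ∩ R)) + sum (χ (S ─ R))        ≡⟨ sym (∑-distrib-+ (χ (S ∩ R)) (χ (S ─ R))) ⟩
  sum (λ i → χ (S ∩ R) i + χ (S ─ R) i)    ≡⟨ sum-cong-≗ (χ-split S R) ⟩
  sum (χ S)                                ≡⟨ sym (∣∣-sum S) ⟩
  ∣ S ∣                                    ∎
  where open ≡-Reasoning

∣∪∣+∣∩∣ : ∀ {p} (S R : Subset p) → ∣ S ∪ R ∣ + ∣ S ∩ R ∣ ≡ ∣ S ∣ + ∣ R ∣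
∣∪∣+∣∩∣ []          []          = refl
∣∪∣+∣∩∣ (true  ∷ S) (true  ∷ R) = cong suc (trans (ℕₚ.+-suc _ _)
  (trans (cong suc (∣∪∣+∣∩∣ S R)) (sym (ℕₚ.+-suc _ _))))
∣∪∣+∣∩∣ (true  ∷ S) (false ∷ R) = cong suc (∣∪∣+∣∩∣ S R)
∣∪∣+∣∩∣ (false ∷ S) (true  ∷ R) = trans (cong suc (∣∪∣+∣∩∣ S R)) (sym (ℕₚ.+-suc _ _))
∣∪∣+∣∩∣ (false ∷ S) (false ∷ R) = ∣∪∣+∣∩∣ S R

-- Membership enters as a factor `χ S i` rather than as a conditional, so that distributivity and
-- interchange of sums in a semiring apply.
Σ∈ : ∀ {p} → Subset p → (Fin p → ℕ) → ℕ
Σ∈ S f = sum (λ i → χ S i * f i)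

Σ∈-mono : ∀ {p} (S : Subset p) {f g : Fin p → ℕ} →
          (∀ {i} → i ∈ S → f i ≤ℕ g i) → Σ∈ S f ≤ℕ Σ∈ S g
Σ∈-mono S {f} {g} h = sum-mono pointwise
  where
  pointwise : ∀ i → χ S i * f i ≤ℕ χ S i * g i
  pointwise i with lookup S i in eq
  ... | true  = ℕₚ.*-monoʳ-≤ 1 (h (lookup⇒[]= i S eq))
  ... | false = z≤n

Σ∈-+ : ∀ {p} (S : Subset p) (f g : Fin p → ℕ) →
       Σ∈ S (λ i → f i + g i) ≡ Σ∈ S f + Σ∈ S g
Σ∈-+ S f g = trans (sum-cong-≗ (λ i → ℕₚ.*-distribˡ-+ (χ S i) (f i) (g i)))
                   (∑-distrib-+ (λ i → χ S i * f i) (λ i → χ S i * g i))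

Σ∈-* : ∀ {p} (S : Subset p) c (f : Fin p → ℕ) → Σ∈ S (λ i → c * f i) ≡ c * Σ∈ S f
Σ∈-* S c f = trans (sum-cong-≗ (λ i → x∙yz≈y∙xz (χ S i) c (f i)))
                   (sym (*-distribˡ-sum c (λ i → χ S i * f i)))

Σ∈-const : ∀ {p} (S : Subset p) c → Σ∈ S (λ _ → c) ≡ c * ∣ S ∣
Σ∈-const S c = trans (sum-cong-≗ (λ i → ℕₚ.*-comm (χ S i) c))
  (trans (sym (*-distribˡ-sum c (χ S))) (cong (c *_) (sym (∣∣-sum S))))

Σ∈-split : ∀ {p} (S R : Subset p) f → Σ∈ (S ∩ R) f + Σ∈ (S ─ R) f ≡ Σ∈ S f
Σ∈-split S R f = trans (sym (∑-distrib-+ (λ i → χ (S ∩ R) i * f i) (λ i → χ (S ─ R) i * f i)))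
  (sum-cong-≗ (λ i → trans (sym (ℕₚ.*-distribʳ-+ (f i) (χ (S ∩ R) i) (χ (S ─ R) i)))
                           (cong (_* f i) (χ-split S R i))))

∣∩∣-Σ∈ : ∀ {p} (S R : Subset p) → ∣ S ∩ R ∣ ≡ Σ∈ S (χ R)
∣∩∣-Σ∈ S R = trans (∣∣-sum (S ∩ R)) (sum-cong-≗ (χ-∩ S R))

Σ∈-swap : ∀ {p q} (S : Subset p) (R : Subset q) (f : Fin p → Fin q → ℕ) →
          Σ∈ S (λ i → Σ∈ R (f i)) ≡ Σ∈ R (λ j → Σ∈ S (λ i → f i j))
Σ∈-swap S R f = begin
  sum (λ i → χ S i * sum (λ j → χ R j * f i j))   ≡⟨ sum-cong-≗ (λ i → *-distribˡ-sum (χ S i) (λ j → χ R j * f i j)) ⟩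
  sum (λ i → sum (λ j → χ S i * (χ R j * f i j))) ≡⟨ ∑-comm (λ i j → χ S i * (χ R j * f i j)) ⟩
  sum (λ j → sum (λ i → χ S i * (χ R j * f i j))) ≡⟨ sum-cong-≗ (λ j → sum-cong-≗ (λ i → x∙yz≈y∙xz (χ S i) (χ R j) (f i j))) ⟩
  sum (λ j → sum (λ i → χ R j * (χ S i * f i j))) ≡⟨ sum-cong-≗ (λ j → sym (*-distribˡ-sum (χ R j) (λ i → χ S i * f i j))) ⟩
  sum (λ j → χ R j * sum (λ i → χ S i * f i j))   ∎
  where
  open ≡-Reasoning

Σ∈-<⇒∃ : ∀ {p} (S : Subset p) (f g : Fin p → ℕ) → Σ∈ S f <ℕ Σ∈ S g →
         ∃[ i ] (i ∈ S × f i <ℕ g i)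
Σ∈-<⇒∃ (outside ∷ S) f g lt =
  let (i , i∈ , h) = Σ∈-<⇒∃ S (λ i → f (suc i)) (λ i → g (suc i)) lt in suc i , there i∈ , h
Σ∈-<⇒∃ (inside ∷ S) f g lt with f zero <? g zero
... | yes f<g = zero , here , f<g
... | no  f≮g =
  let (i , i∈ , h) = Σ∈-<⇒∃ S (λ i → f (suc i)) (λ i → g (suc i)) rest in suc i , there i∈ , h
  where
  rest : Σ∈ S (λ i → f (suc i)) <ℕ Σ∈ S (λ i → g (suc i))
  rest = ℕₚ.+-cancelˡ-< (1 * f zero) _ _ (ℕₚ.<-≤-trans lt
    (ℕₚ.+-monoˡ-≤ _ (ℕₚ.*-monoʳ-≤ 1 (ℕₚ.≮⇒≥ f≮g))))

x∈S⇒0<∣S∣ : ∀ {p} {S : Subset p} {x} → x ∈ S → 0 <ℕ ∣ S ∣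
x∈S⇒0<∣S∣ {S = S} {x} x∈ = subst (_≤ℕ ∣ S ∣) (∣⁅x⁆∣≡1 x)
  (p⊆q⇒∣p∣≤∣q∣ (λ y∈ → subst (_∈ S) (sym (x∈⁅y⁆⇒x≡y x y∈)) x∈))

-- Since `S` is nonempty, adding 1 to each `g i` makes the inequality of sums strict, and `Σ∈-<⇒∃`
-- applies.
Σ∈-≤⇒∃ : ∀ {p} (S : Subset p) (f g : Fin p → ℕ) → Nonempty S → Σ∈ S f ≤ℕ Σ∈ S g →
         ∃[ i ] (i ∈ S × f i ≤ℕ g i)
Σ∈-≤⇒∃ S f g (x , x∈) le =
  let (i , i∈ , h) = Σ∈-<⇒∃ S f (λ i → 1 + g i) lt in i , i∈ , ℕₚ.≤-pred h
  where
  lt : Σ∈ S f <ℕ Σ∈ S (λ i → 1 + g i)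
  lt = subst (Σ∈ S f <ℕ_) (sym (trans (Σ∈-+ S (λ _ → 1) g)
         (cong (_+ Σ∈ S g) (trans (Σ∈-const S 1) (ℕₚ.*-identityˡ _)))))
         (ℕₚ.+-mono-≤ (x∈S⇒0<∣S∣ x∈) le)

shrink : ∀ {p} (S : Subset p) n → n ≤ℕ ∣ S ∣ → ∃[ R ] (R ⊆ S × ∣ R ∣ ≡ n)
shrink []            zero    _       = [] , (λ x∈ → x∈) , refl
shrink (outside ∷ S) n       h       =
  let (R , R⊆S , eq) = shrink S n h in outside ∷ R , s⊆s R⊆S , eq
shrink (inside ∷ S)  zero    _       =
  let (R , R⊆S , eq) = shrink S 0 z≤n in outside ∷ R , out⊆ R⊆S , eq
shrink (inside ∷ S)  (suc n) (s≤s h) =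
  let (R , R⊆S , eq) = shrink S n h in inside ∷ R , s⊆s R⊆S , cong suc eq

x∈p─q⇒x∉q : ∀ {p} (S R : Subset p) {x} → x ∈ S ─ R → x ∉ R
x∈p─q⇒x∉q (s ∷ S) (inside  ∷ R) {zero}  ()         here
x∈p─q⇒x∉q (s ∷ S) (outside ∷ R) {zero}  _          ()
x∈p─q⇒x∉q (s ∷ S) (_ ∷ R)       {suc x} (there x∈) (there x∈R) = x∈p─q⇒x∉q S R x∈ x∈R

-- Greedy partition into stars

-- The weight charged for a star with d vertices.  The second term exceeds the
-- first only if d > (r + 1) n, which happens for at most one star.
cost : ℕ → ℕ → ℕ → ℕ
cost r n d = (suc r * (n ⊓ d) + r * d) ⊔ (suc r * d)

-- In the application `W a` is the trimmed neighbourhood of `a` in `B`, empty for `a` outside `A`;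
-- `X b` is the neighbourhood of `b` in `C`, `y₀` the least size of an `X b`, and `M` the largest
-- `∣ N²A c ∣`.
module Greedy {p s t} (B : Subset p) (W : Fin s → Subset p) (X : Fin p → Subset t)
              (n M r y₀ : ℕ) (∣W∣≤n : ∀ a → ∣ W a ∣ ≤ℕ n)
              (0<y₀ : 0 <ℕ y₀) (y₀≤∣X∣ : ∀ {b} → b ∈ B → y₀ ≤ℕ ∣ X b ∣) where

  -- The transpose of `W`: it plays the role of N(b) ∩ A after trimming.
  T : Fin p → Subset s
  T b = tabulate (λ a → lookup (W a) b)

  χT : ∀ b a → χ (T b) a ≡ χ (W a) b
  χT b a rewrite lookup∘tabulate (λ a → lookup (W a) b) a = refl

  Sh : Fin p → Subset p
  Sh b = tabulate (λ b′ → does (nonempty? (X b ∩ X b′)))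

  ∈Sh⁺ : ∀ {b b′} → Nonempty (X b ∩ X b′) → b′ ∈ Sh b
  ∈Sh⁺ {b} {b′} ne = lookup⇒[]= b′ (Sh b)
    (trans (lookup∘tabulate _ b′) (dec-true (nonempty? _) ne))

  ∈Sh⁻ : ∀ {b b′} → b′ ∈ Sh b → Nonempty (X b ∩ X b′)
  ∈Sh⁻ {b} {b′} b′∈ with nonempty? (X b ∩ X b′)
                       | trans (sym (lookup∘tabulate (λ b′ → does (nonempty? (X b ∩ X b′))) b′)) ([]=⇒lookup b′∈)
  ... | yes ne | _  = ne
  ... | no  _  | ()

  χSh-sym : ∀ b b′ → χ (Sh b) b′ ≡ χ (Sh b′) b
  χSh-sym b b′ rewrite lookup∘tabulate (λ b′ → does (nonempty? (X b ∩ X b′))) b′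
                     | lookup∘tabulate (λ b → does (nonempty? (X b′ ∩ X b))) b
                     | ∩-comm (X b) (X b′) = refl

  -- `X b` is nonempty because `y₀` is positive, so `b` is linked to itself. Hence deleting a star
  -- always shrinks the remaining set, and `pair` applied to `b` twice bounds `∣ T b ∣` by `M`.
  b∈Sh : ∀ {b} → b ∈ B → b ∈ Sh b
  b∈Sh {b} b∈B = ∈Sh⁺ (subst Nonempty (sym (∩-idem (X b)))
    (size⇒nonempty (X b) (ℕₚ.<-≤-trans 0<y₀ (y₀≤∣X∣ b∈B))))

  e : Subset p → ℕ
  e S = Σ∈ S (λ b → ∣ T b ∣)

  e-B : (∀ a → W a ⊆ B) → e B ≡ sum (λ a → ∣ W a ∣)
  e-B W⊆B = begin
    Σ∈ B (λ b → ∣ T b ∣)                           ≡⟨ sum-cong-≗ (λ b → cong (χ B b *_) (trans (∣∣-sum (T b)) (sum-cong-≗ (χT b)))) ⟩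
    Σ∈ B (λ b → sum (λ a → χ (W a) b))             ≡⟨ sum-cong-≗ (λ b → *-distribˡ-sum (χ B b) (λ a → χ (W a) b)) ⟩
    sum (λ b → sum (λ a → χ B b * χ (W a) b))      ≡⟨ ∑-comm (λ b a → χ B b * χ (W a) b) ⟩
    sum (λ a → Σ∈ B (χ (W a)))                     ≡⟨ sum-cong-≗ (λ a → sym (∣∩∣-Σ∈ B (W a))) ⟩
    sum (λ a → ∣ B ∩ W a ∣)                        ≡⟨ sum-cong-≗ (λ a → cong ∣_∣ (⊆-antisym (p∩q⊆q B (W a)) (λ x∈ → x∈p∩q⁺ (W⊆B a x∈ , x∈)))) ⟩
    sum (λ a → ∣ W a ∣)                            ∎
    where open ≡-Reasoning

  module _ (pair : ∀ {b b′} → b ∈ B → b′ ∈ B → Nonempty (X b ∩ X b′) → ∣ T b ∪ T b′ ∣ ≤ℕ M) where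

    -- After interchanging the sums, each `a ∈ T b` contributes `∣ S ∩ W a ∣`, which is at most `n`
    -- and at most `∣ S ∣`.
    ΣT∩T≤ : ∀ S b → Σ∈ S (λ b′ → ∣ T b ∩ T b′ ∣) ≤ℕ (n ⊓ ∣ S ∣) * ∣ T b ∣
    ΣT∩T≤ S b = begin
      Σ∈ S (λ b′ → ∣ T b ∩ T b′ ∣)                 ≡⟨ sum-cong-≗ (λ b′ → cong (χ S b′ *_) (∣∩∣-Σ∈ (T b) (T b′))) ⟩
      Σ∈ S (λ b′ → Σ∈ (T b) (χ (T b′)))            ≡⟨ Σ∈-swap S (T b) (λ b′ → χ (T b′)) ⟩
      Σ∈ (T b) (λ a → Σ∈ S (λ b′ → χ (T b′) a))    ≡⟨ sum-cong-≗ (λ a → cong (χ (T b) a *_) (trans (sum-cong-≗ (λ b′ → cong (χ S b′ *_) (χT b′ a))) (sym (∣∩∣-Σ∈ S (W a))))) ⟩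
      Σ∈ (T b) (λ a → ∣ S ∩ W a ∣)                 ≤⟨ Σ∈-mono (T b) (λ {a} _ → ℕₚ.⊓-glb (ℕₚ.≤-trans (∣p∩q∣≤∣q∣ S (W a)) (∣W∣≤n a)) (∣p∩q∣≤∣p∣ S (W a))) ⟩
      Σ∈ (T b) (λ _ → n ⊓ ∣ S ∣)                   ≡⟨ Σ∈-const (T b) (n ⊓ ∣ S ∣) ⟩
      (n ⊓ ∣ S ∣) * ∣ T b ∣                        ∎
      where open ℕₚ.≤-Reasoning

    -- Here `D` is the size of a star, `w` is `n ⊓ D`, `ν` is `∣ T b ∣` for the centre and `ε` is
    -- `e` of the star. Bounding `ε` by the second hypothesis leaves `suc r * D * M` plus `ν` times
    -- `suc r * w - D`, a coefficient of either sign. The two lower bounds on `L` say that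
    -- `L - suc r * D` is at least this coefficient and at least 0, so `ν` may be replaced by `M`.
    star-arithmetic : ∀ D w ν ε L → ν ≤ℕ M → ν * D + ε ≤ℕ M * D + w * ν →
                 suc r * w + r * D ≤ℕ L → suc r * D ≤ℕ L →
                 r * (D * ν) + suc r * ε ≤ℕ L * M
    star-arithmetic D w ν ε L ν≤M h₁ h₂ h₃ with ℕₚ.m≤n⇒∃[o]m+o≡n h₃
    -- `L′` is the slack `L - suc r * D`; adding `suc r * (w * ν)` to both sides keeps the
    -- computation free of subtraction.
    ... | L′ , refl = ℕₚ.+-cancelʳ-≤ (suc r * (w * ν)) _ _ (begin
      r * (D * ν) + suc r * ε + suc r * (w * ν)          ≡⟨ i₁ r D ν ε w ⟩
      (suc r * w + r * D) * ν + suc r * ε                ≤⟨ ℕₚ.+-monoˡ-≤ (suc r * ε) (ℕₚ.*-monoˡ-≤ ν h₂) ⟩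
      (suc r * D + L′) * ν + suc r * ε                   ≡⟨ i₂ r D ν ε L′ ⟩
      suc r * (ν * D + ε) + L′ * ν                       ≤⟨ ℕₚ.+-mono-≤ (ℕₚ.*-monoʳ-≤ (suc r) h₁) (ℕₚ.*-monoʳ-≤ L′ ν≤M) ⟩
      suc r * (M * D + w * ν) + L′ * M                   ≡⟨ i₃ r D ν w L′ M ⟩
      (suc r * D + L′) * M + suc r * (w * ν)             ∎)
      where
      open ℕₚ.≤-Reasoning
      i₁ : ∀ r D ν ε w → r * (D * ν) + suc r * ε + suc r * (w * ν) ≡ (suc r * w + r * D) * ν + suc r * ε
      i₁ = solve-∀
      i₂ : ∀ r D ν ε L′ → (suc r * D + L′) * ν + suc r * ε ≡ suc r * (ν * D + ε) + L′ * ν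
      i₂ = solve-∀
      i₃ : ∀ r D ν w L′ M → suc r * (M * D + w * ν) + L′ * M ≡ (suc r * D + L′) * M + suc r * (w * ν)
      i₃ = solve-∀

    module _ {R : Subset p} (R⊆B : R ⊆ B) where

      -- Sum the bound `∣ T b ∣ + ∣ T b′ ∣ ≤ M + ∣ T b ∩ T b′ ∣` over the vertices `b′` of the star,
      -- using `ΣT∩T≤` for the intersections. The two terms on the left are kept apart because they
      -- agree only after summation over `b`.
      star : ∀ {b} → b ∈ R →
             r * (∣ R ∩ Sh b ∣ * ∣ T b ∣) + suc r * e (R ∩ Sh b) ≤ℕ cost r n ∣ R ∩ Sh b ∣ * M
      star {b} b∈R = star-arithmetic (∣ S ∣) (n ⊓ ∣ S ∣) (∣ T b ∣) (e S) _
        (ℕₚ.≤-trans (∣p∣≤∣p∪q∣ (T b) (T b)) (pair (R⊆B b∈R) (R⊆B b∈R) (∈Sh⁻ (b∈Sh (R⊆B b∈R)))))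
        (begin
          ∣ T b ∣ * ∣ S ∣ + e S                                     ≡⟨ cong (_+ e S) (sym (Σ∈-const S (∣ T b ∣))) ⟩
          Σ∈ S (λ _ → ∣ T b ∣) + e S                                ≡⟨ sym (Σ∈-+ S (λ _ → ∣ T b ∣) (λ b′ → ∣ T b′ ∣)) ⟩
          Σ∈ S (λ b′ → ∣ T b ∣ + ∣ T b′ ∣)                          ≤⟨ Σ∈-mono S each ⟩
          Σ∈ S (λ b′ → M + ∣ T b ∩ T b′ ∣)                          ≡⟨ Σ∈-+ S (λ _ → M) (λ b′ → ∣ T b ∩ T b′ ∣) ⟩
          Σ∈ S (λ _ → M) + Σ∈ S (λ b′ → ∣ T b ∩ T b′ ∣)             ≤⟨ ℕₚ.+-mono-≤ (ℕₚ.≤-reflexive (Σ∈-const S M)) (ΣT∩T≤ S b) ⟩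
          M * ∣ S ∣ + (n ⊓ ∣ S ∣) * ∣ T b ∣                         ∎)
        (ℕₚ.m≤m⊔n _ _) (ℕₚ.m≤n⊔m (suc r * (n ⊓ ∣ S ∣) + r * ∣ S ∣) _)
        where
        open ℕₚ.≤-Reasoning
        S = R ∩ Sh b
        each : ∀ {b′} → b′ ∈ S → ∣ T b ∣ + ∣ T b′ ∣ ≤ℕ M + ∣ T b ∩ T b′ ∣
        each {b′} b′∈S = let (b′∈R , b′∈Sh) = x∈p∩q⁻ R (Sh b) b′∈S in
          subst (_≤ℕ M + ∣ T b ∩ T b′ ∣) (∣∪∣+∣∩∣ (T b) (T b′))
            (ℕₚ.+-monoˡ-≤ (∣ T b ∩ T b′ ∣) (pair (R⊆B b∈R) (R⊆B b′∈R) (∈Sh⁻ b′∈Sh)))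

      -- Both sides sum over ordered linked pairs in `R`, weighted by `∣ T ∣` of the centre on the
      -- left and of the other vertex on the right; linking is symmetric.
      transpose : Σ∈ R (λ b → ∣ R ∩ Sh b ∣ * ∣ T b ∣) ≡ Σ∈ R (λ b → e (R ∩ Sh b))
      transpose = begin
        Σ∈ R (λ b → ∣ R ∩ Sh b ∣ * ∣ T b ∣)                          ≡⟨ sum-cong-≗ (λ b → cong (χ R b *_) (left b)) ⟩
        Σ∈ R (λ b → Σ∈ R (λ b′ → χ (Sh b) b′ * ∣ T b ∣))             ≡⟨ Σ∈-swap R R (λ b b′ → χ (Sh b) b′ * ∣ T b ∣) ⟩
        Σ∈ R (λ b → Σ∈ R (λ b′ → χ (Sh b′) b * ∣ T b′ ∣))            ≡⟨ sum-cong-≗ (λ b → cong (χ R b *_) (right b)) ⟩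
        Σ∈ R (λ b → e (R ∩ Sh b))                                    ∎
        where
        open ≡-Reasoning
        left : ∀ b → ∣ R ∩ Sh b ∣ * ∣ T b ∣ ≡ Σ∈ R (λ b′ → χ (Sh b) b′ * ∣ T b ∣)
        left b = begin
          ∣ R ∩ Sh b ∣ * ∣ T b ∣                     ≡⟨ ℕₚ.*-comm (∣ R ∩ Sh b ∣) _ ⟩
          ∣ T b ∣ * ∣ R ∩ Sh b ∣                     ≡⟨ cong (∣ T b ∣ *_) (∣∩∣-Σ∈ R (Sh b)) ⟩
          ∣ T b ∣ * Σ∈ R (χ (Sh b))                  ≡⟨ sym (Σ∈-* R (∣ T b ∣) (χ (Sh b))) ⟩
          Σ∈ R (λ b′ → ∣ T b ∣ * χ (Sh b) b′)        ≡⟨ sum-cong-≗ (λ b′ → cong (χ R b′ *_) (ℕₚ.*-comm (∣ T b ∣) _)) ⟩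
          Σ∈ R (λ b′ → χ (Sh b) b′ * ∣ T b ∣)        ∎
        right : ∀ b → Σ∈ R (λ b′ → χ (Sh b′) b * ∣ T b′ ∣) ≡ e (R ∩ Sh b)
        right b = sum-cong-≗ (λ b′ → begin
          χ R b′ * (χ (Sh b′) b * ∣ T b′ ∣)          ≡⟨ cong (λ x → χ R b′ * (x * ∣ T b′ ∣)) (χSh-sym b′ b) ⟩
          χ R b′ * (χ (Sh b) b′ * ∣ T b′ ∣)          ≡⟨ sym (ℕₚ.*-assoc (χ R b′) _ _) ⟩
          χ R b′ * χ (Sh b) b′ * ∣ T b′ ∣            ≡⟨ cong (_* ∣ T b′ ∣) (sym (χ-∩ R (Sh b) b′)) ⟩
          χ (R ∩ Sh b) b′ * ∣ T b′ ∣                 ∎)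

      -- Average `star` over `R`: by `transpose` its two left terms have equal sums, so the weights
      -- `r` and `suc r` add up to 2k - 3.
      cheap-star : Nonempty R →
        ∃[ b ] (b ∈ R × (r + suc r) * e (R ∩ Sh b) ≤ℕ cost r n ∣ R ∩ Sh b ∣ * M)
      cheap-star ne = Σ∈-≤⇒∃ R (λ b → (r + suc r) * ε b) (λ b → cost r n ∣ R ∩ Sh b ∣ * M) ne (begin
        Σ∈ R (λ b → (r + suc r) * e (R ∩ Sh b))      ≡⟨ Σ∈-* R (r + suc r) ε ⟩
        (r + suc r) * E                              ≡⟨ ℕₚ.*-distribʳ-+ E r (suc r) ⟩
        r * E + suc r * E                            ≡⟨ cong₂ _+_ (trans (cong (r *_) (sym transpose)) (sym (Σ∈-* R r δ))) (sym (Σ∈-* R (suc r) ε)) ⟩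
        Σ∈ R (λ b → r * (∣ R ∩ Sh b ∣ * ∣ T b ∣)) + Σ∈ R (λ b → suc r * e (R ∩ Sh b))
                                                     ≡⟨ sym (Σ∈-+ R (λ b → r * δ b) (λ b → suc r * ε b)) ⟩
        Σ∈ R (λ b → r * (∣ R ∩ Sh b ∣ * ∣ T b ∣) + suc r * e (R ∩ Sh b))
                                                     ≤⟨ Σ∈-mono R star ⟩
        Σ∈ R (λ b → cost r n ∣ R ∩ Sh b ∣ * M)       ∎)
        where
        open ℕₚ.≤-Reasoning
        ε δ : Fin p → ℕ
        ε b = e (R ∩ Sh b)
        δ b = ∣ R ∩ Sh b ∣ * ∣ T b ∣
        E = Σ∈ R ε

    -- Only the sizes `ds` of the stars are recorded. In the construction `Q` is the part of `C`
    -- outside `X` of all earlier centres; later centres have disjoint sets `X b` inside `Q`, each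
    -- of size at least `y₀`, which bounds the number of stars.
    StarPartition : Subset p → Subset t → Set
    StarPartition R Q = ∃[ ds ] (sumᴸ ds ≤ℕ ∣ R ∣ × length ds * y₀ ≤ℕ ∣ Q ∣ ×
                                 (r + suc r) * e R ≤ℕ sumᴸ (map (cost r n) ds) * M)

    add-star : ∀ {R Q b} → R ⊆ B → b ∈ R → X b ⊆ Q →
               (r + suc r) * e (R ∩ Sh b) ≤ℕ cost r n ∣ R ∩ Sh b ∣ * M →
               StarPartition (R ─ Sh b) (Q ─ X b) → StarPartition R Q
    add-star {R} {Q} {b} R⊆B b∈R Xb⊆Q cheap (ds , sum≤ , len≤ , e≤) =
        ∣ R ∩ Sh b ∣ ∷ ds
      , ℕₚ.≤-trans (ℕₚ.+-monoʳ-≤ (∣ R ∩ Sh b ∣) sum≤) (ℕₚ.≤-reflexive (∣∩∣+∣─∣ R (Sh b)))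
      , ℕₚ.≤-trans (ℕₚ.+-mono-≤ (ℕₚ.≤-trans (y₀≤∣X∣ (R⊆B b∈R)) (p⊆q⇒∣p∣≤∣q∣ (λ c∈ → x∈p∩q⁺ (Xb⊆Q c∈ , c∈)))) len≤)
                   (ℕₚ.≤-reflexive (∣∩∣+∣─∣ Q (X b)))
      , (begin
          (r + suc r) * e R                                           ≡⟨ cong ((r + suc r) *_) (sym (Σ∈-split R (Sh b) (λ b → ∣ T b ∣))) ⟩
          (r + suc r) * (e (R ∩ Sh b) + e (R ─ Sh b))                 ≡⟨ ℕₚ.*-distribˡ-+ (r + suc r) (e (R ∩ Sh b)) (e (R ─ Sh b)) ⟩
          (r + suc r) * e (R ∩ Sh b) + (r + suc r) * e (R ─ Sh b)     ≤⟨ ℕₚ.+-mono-≤ cheap e≤ ⟩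
          cost r n ∣ R ∩ Sh b ∣ * M + sumᴸ (map (cost r n) ds) * M    ≡⟨ sym (ℕₚ.*-distribʳ-+ M (cost r n ∣ R ∩ Sh b ∣) _) ⟩
          (cost r n ∣ R ∩ Sh b ∣ + sumᴸ (map (cost r n) ds)) * M      ∎)
      where open ℕₚ.≤-Reasoning

    empty-partition : ∀ R Q → Empty R → StarPartition R Q
    empty-partition R Q ∅ =
      [] , z≤n , z≤n , ℕₚ.≤-reflexive (trans (cong ((r + suc r) *_) eR≡0) (ℕₚ.*-zeroʳ (r + suc r)))
      where
      eR≡0 : e R ≡ 0
      eR≡0 = ℕₚ.n≤0⇒n≡0 (ℕₚ.≤-trans (Σ∈-mono R {λ b → ∣ T b ∣} {λ _ → 0} (λ b∈ → ⊥-elim (∅ (_ , b∈))))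
                                      (ℕₚ.≤-reflexive (Σ∈-const R 0)))

    star-partition : ∀ fuel (R : Subset p) (Q : Subset t) → ∣ R ∣ <ℕ fuel → R ⊆ B →
                     (∀ {b} → b ∈ R → X b ⊆ Q) → StarPartition R Q
    star-partition (suc fuel) R Q ∣R∣< R⊆B X⊆Q = case nonempty? R of λ where
      (no ∅)   → empty-partition R Q ∅
      (yes ne) → case cheap-star R⊆B ne of λ where
        (b , b∈R , cheap) → add-star R⊆B b∈R (X⊆Q b∈R) cheap
          (star-partition fuel (R ─ Sh b) (Q ─ X b)
            (ℕₚ.<-≤-trans (p∩q≢∅⇒∣p─q∣<∣p∣ R (Sh b) (b , x∈p∩q⁺ (b∈R , b∈Sh (R⊆B b∈R)))) (ℕₚ.≤-pred ∣R∣<))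
            (λ x∈ → R⊆B (p─q⊆p R (Sh b) x∈))
            -- A remaining `b′` is not linked to the centre `b`, so `X b′` avoids `X b` and stays
            -- inside the new `Q`.
            (λ b′∈ {c} c∈ → x∈p∧x∉q⇒x∈p─q (X⊆Q (p─q⊆p R (Sh b) b′∈) c∈)
              (λ c∈X → x∈p─q⇒x∉q R (Sh b) b′∈ (∈Sh⁺ (c , x∈p∩q⁺ (c∈X , c∈))))))

-- Bounding the total cost of the stars

cost≤ : ∀ r n d → cost r n d ≤ℕ (r + suc r) * d
cost≤ r n d = ℕₚ.⊔-lub
  (ℕₚ.≤-trans (ℕₚ.+-monoˡ-≤ (r * d) (ℕₚ.*-monoʳ-≤ (suc r) (ℕₚ.m⊓n≤n n d)))
    (ℕₚ.≤-reflexive (identity r d)))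
  (ℕₚ.*-monoˡ-≤ d (ℕₚ.m≤n+m (suc r) r))
  where
  identity : ∀ r d → suc r * d + r * d ≡ (r + suc r) * d
  identity = solve-∀

cost-small : ∀ r n d → d ≤ℕ suc r * n → cost r n d ≤ℕ suc r * n + r * d
cost-small r n d d≤ = ℕₚ.⊔-lub
  (ℕₚ.+-monoˡ-≤ (r * d) (ℕₚ.*-monoʳ-≤ (suc r) (ℕₚ.m⊓n≤m n d)))
  (ℕₚ.+-monoˡ-≤ (r * d) d≤)

-- Both terms of the maximum are now at most `suc r * d`. This saves `r * d` against `cost≤`, of
-- which `r * (suc r * n)` is retained.
cost-large : ∀ r n d → suc r * n ≤ℕ d → cost r n d + r * (suc r * n) ≤ℕ (r + suc r) * d
cost-large r n d ≤d = begin
  cost r n d + r * (suc r * n)   ≤⟨ ℕₚ.+-mono-≤ (ℕₚ.⊔-lub (ℕₚ.+-monoˡ-≤ (r * d)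
                                      (ℕₚ.≤-trans (ℕₚ.*-monoʳ-≤ (suc r) (ℕₚ.m⊓n≤m n d)) ≤d)) ℕₚ.≤-refl)
                                      (ℕₚ.*-monoʳ-≤ r ≤d) ⟩
  suc r * d + r * d              ≡⟨ identity r d ⟩
  (r + suc r) * d                ∎
  where
  open ℕₚ.≤-Reasoning
  identity : ∀ r d → suc r * d + r * d ≡ (r + suc r) * d
  identity = solve-∀

Σcost≤ : ∀ r n ds → sumᴸ (map (cost r n) ds) ≤ℕ (r + suc r) * sumᴸ ds
Σcost≤ r n []       = z≤n
Σcost≤ r n (d ∷ ds) = ℕₚ.≤-trans (ℕₚ.+-mono-≤ (cost≤ r n d) (Σcost≤ r n ds))
  (ℕₚ.≤-reflexive (sym (ℕₚ.*-distribˡ-+ (r + suc r) d (sumᴸ ds))))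

-- Either `cost-small` applies to every star, or some star is large; then its saving from
-- `cost-large` is kept and the other stars are bounded by `cost≤`.
Σcost-dichotomy : ∀ r n ds →
  sumᴸ (map (cost r n) ds) ≤ℕ length ds * (suc r * n) + r * sumᴸ ds ⊎
  sumᴸ (map (cost r n) ds) + r * (suc r * n) ≤ℕ (r + suc r) * sumᴸ ds
Σcost-dichotomy r n [] = inj₁ z≤n
Σcost-dichotomy r n (d ∷ ds) with ℕₚ.≤-total d (suc r * n) | Σcost-dichotomy r n ds
... | inj₁ d≤ | inj₁ h = inj₁ (ℕₚ.≤-trans (ℕₚ.+-mono-≤ (cost-small r n d d≤) h)
        (ℕₚ.≤-reflexive (regroup (suc r * n) r d (length ds * (suc r * n)) (sumᴸ ds))))
  where
  regroup : ∀ x r d y s → x + r * d + (y + r * s) ≡ x + y + r * (d + s)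
  regroup = solve-∀
... | inj₁ d≤ | inj₂ h = inj₂ (ℕₚ.≤-trans (ℕₚ.≤-reflexive (ℕₚ.+-assoc (cost r n d) _ _))
        (ℕₚ.≤-trans (ℕₚ.+-mono-≤ (cost≤ r n d) h)
          (ℕₚ.≤-reflexive (sym (ℕₚ.*-distribˡ-+ (r + suc r) d (sumᴸ ds))))))
... | inj₂ ≤d | _      = inj₂ (ℕₚ.≤-trans (ℕₚ.≤-reflexive (regroup (cost r n d) _ (r * (suc r * n))))
        (ℕₚ.≤-trans (ℕₚ.+-mono-≤ (cost-large r n d ≤d) (Σcost≤ r n ds))
          (ℕₚ.≤-reflexive (sym (ℕₚ.*-distribˡ-+ (r + suc r) d (sumᴸ ds))))))
  where
  regroup : ∀ x y z → x + y + z ≡ x + z + y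
  regroup = solve-∀

-- This is 2k² - 4k + 1 for k = r + 2, written without subtraction.
denominator : ℕ → ℕ
denominator r = suc (2 * (r * r) + 4 * r)

Σcost-bound : ∀ q n ds → let r = suc q in
  length ds ≤ℕ suc r → sumᴸ ds ≤ℕ suc (suc r) * n →
  sumᴸ (map (cost r n) ds) ≤ℕ denominator r * n
Σcost-bound q n ds len≤ sum≤ with Σcost-dichotomy (suc q) n ds
-- At most r + 1 stars of total size at most (r + 2) n give the coefficient (r + 1)² + r (r + 2),
-- which is exactly `denominator r`.
... | inj₁ h = ℕₚ.≤-trans h (ℕₚ.≤-trans
        (ℕₚ.+-mono-≤ (ℕₚ.*-monoˡ-≤ (suc (suc q) * n) len≤) (ℕₚ.*-monoʳ-≤ (suc q) sum≤))
        (ℕₚ.≤-reflexive (identity q n)))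
  where
  identity : ∀ q n → suc (suc q) * (suc (suc q) * n) + suc q * (suc (suc (suc q)) * n)
                   ≡ suc (2 * (suc q * suc q) + 4 * suc q) * n
  identity = solve-∀
... | inj₂ h = ℕₚ.+-cancelʳ-≤ (suc q * (suc (suc q) * n)) _ _ (ℕₚ.≤-trans h
        (ℕₚ.≤-trans (ℕₚ.*-monoʳ-≤ (suc q + suc (suc q)) sum≤)
        -- `q * (q + 2)` is r² - 1, the room left when one star is large. It would be negative for r
        -- = 0, hence the form `r = suc q`.
        (ℕₚ.≤-trans (ℕₚ.m≤m+n _ (q * (q + 2) * n))
          (ℕₚ.≤-reflexive (identity q n)))))
  where
  identity : ∀ q n → (suc q + suc (suc q)) * (suc (suc (suc q)) * n) + q * (q + 2) * n
                   ≡ suc (2 * (suc q * suc q) + 4 * suc q) * n + suc q * (suc (suc q) * n)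
  identity = solve-∀

-- The bound for graphs

-- Vertices outside `A` receive the empty set, so sums over all vertices see only `A`. The exact
-- size serves twice: as an upper bound in `ΣT∩T≤` and for the count `e-B≡`.
trim : ∀ {p} (A : Subset p) (P : Fin p → Subset p) n →
       (∀ {a} → a ∈ A → n ≤ℕ ∣ P a ∣) → ∀ a →
       ∃[ R ] (R ⊆ P a × ∣ R ∣ ≡ n * χ A a × (∀ {b} → b ∈ R → a ∈ A))
trim {p} A P n n≤ a with lookup A a in eq
... | true  = let a∈A = lookup⇒[]= a A eq
                  (R , R⊆P , ∣R∣≡n) = shrink (P a) n (n≤ a∈A)
              in R , R⊆P , trans ∣R∣≡n (sym (ℕₚ.*-identityʳ n)) , λ _ → a∈A
... | false = ⊥ , ⊥-elim ∘ ∉⊥ , trans (∣⊥∣≡0 p) (sym (ℕₚ.*-zeroʳ n)) , ⊥-elim ∘ ∉⊥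

module Counting (r : ℕ) (G : Graph) (T : Tripartition G) where
  open Graph G
  open Tripartition T

  module _
    (A-to-C : ∀ {a c} → a ∈ A → c ∈ C → c ∉ N a)
    (A-to-B : ∀ {a} → a ∈ A → ∣ B ∣ ≤ℕ suc (suc r) * ∣ N a ∩ B ∣)
    (B-to-C : ∀ {b} → b ∈ B → ∣ C ∣ <ℕ suc (suc r) * ∣ N b ∩ C ∣) where

    X : Vertex → Subset order
    X b = N b ∩ C

    -- The walk from `c` through `b` to `a` has length two. Disjointness of `A` and `C` excludes
    -- length zero, and the absence of edges between them excludes length one.
    ∈N²⁺ : ∀ {a b c} → a ∈ A → b ∈ N a → c ∈ N b → c ∈ C → a ∈ N² c
    ∈N²⁺ {a} {b} {c} a∈A b∈Na c∈Nb c∈C = lookup⇒[]= a (N² c)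
      (trans (lookup∘tabulate (λ u → does (atDistance? 2 c u)) a)
        (dec-true (atDistance? 2 c a) ((b , symmetric c∈Nb , a , symmetric b∈Na , refl) , short)))
      where
      short : ∀ {ℓ} → ℓ <ℕ 2 → ¬ Walk ℓ c a
      short {0} _ refl = A∩C-empty (a , x∈p∩q⁺ (a∈A , c∈C))
      short {1} _ (_ , a∈Nc , refl) = A-to-C a∈A c∈C (symmetric a∈Nc)
      short {suc (suc _)} (s≤s (s≤s ()))

    best-v = max-on C (λ v → ∣ N²A v ∣) C-nonempty
    v      = proj₁ best-v
    v∈C    = proj₁ (proj₂ best-v)
    v-max  = proj₂ (proj₂ best-v)

    best-a = min-on A (λ a → ∣ N a ∩ B ∣) A-nonempty
    best-b = min-on B (λ b → ∣ X b ∣) B-nonempty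

    n y₀ M : ℕ
    n  = ∣ N (proj₁ best-a) ∩ B ∣
    y₀ = ∣ X (proj₁ best-b) ∣
    M  = ∣ N²A v ∣

    ∣B∣≤kn : ∣ B ∣ ≤ℕ suc (suc r) * n
    ∣B∣≤kn = A-to-B (proj₁ (proj₂ best-a))

    ∣C∣<ky₀ : ∣ C ∣ <ℕ suc (suc r) * y₀
    ∣C∣<ky₀ = B-to-C (proj₁ (proj₂ best-b))

    0<B : 0 <ℕ ∣ B ∣
    0<B = x∈S⇒0<∣S∣ (proj₂ B-nonempty)

    0<*⇒0< : ∀ c d → 0 <ℕ c * d → 0 <ℕ d
    0<*⇒0< c zero    h = subst (0 <ℕ_) (ℕₚ.*-zeroʳ c) h
    0<*⇒0< c (suc d) h = s≤s z≤n

    0<n : 0 <ℕ n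
    0<n = 0<*⇒0< (suc (suc r)) n (ℕₚ.<-≤-trans 0<B ∣B∣≤kn)

    0<y₀ : 0 <ℕ y₀
    0<y₀ = 0<*⇒0< (suc (suc r)) y₀ (ℕₚ.≤-<-trans z≤n ∣C∣<ky₀)

    trimmed = trim A (λ a → N a ∩ B) n (λ {a} a∈A → proj₂ (proj₂ best-a) a a∈A)
    W : Vertex → Subset order
    W a = proj₁ (trimmed a)

    ∣W∣ : ∀ a → ∣ W a ∣ ≡ n * χ A a
    ∣W∣ a = proj₁ (proj₂ (proj₂ (trimmed a)))

    ∣W∣≤n : ∀ a → ∣ W a ∣ ≤ℕ n
    ∣W∣≤n a = ℕₚ.≤-trans (ℕₚ.≤-reflexive (∣W∣ a))
      (ℕₚ.≤-trans (ℕₚ.*-monoʳ-≤ n χ≤1) (ℕₚ.≤-reflexive (ℕₚ.*-identityʳ n)))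
      where
      χ≤1 : χ A a ≤ℕ 1
      χ≤1 with lookup A a
      ... | true  = ℕₚ.≤-refl
      ... | false = z≤n

    ∈W⁻ : ∀ {a b} → b ∈ W a → a ∈ A × b ∈ N a × b ∈ B
    ∈W⁻ {a} b∈W = proj₂ (proj₂ (proj₂ (trimmed a))) b∈W , x∈p∩q⁻ (N a) B (proj₁ (proj₂ (trimmed a)) b∈W)

    open Greedy B W X n M r y₀ ∣W∣≤n 0<y₀ (λ {b} b∈B → proj₂ (proj₂ best-b) b b∈B)
      renaming (T to S)

    S⊆ : ∀ {b c} → c ∈ X b → S b ⊆ N²A c
    S⊆ {b} {c} c∈X {a} a∈S =
      let (a∈A , b∈Na , _) = ∈W⁻ (lookup⇒[]= b (W a) (trans (sym (lookup∘tabulate (λ a → lookup (W a) b) a)) ([]=⇒lookup a∈S)))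
          (c∈Nb , c∈C) = x∈p∩q⁻ (N b) C c∈X
      in x∈p∩q⁺ (∈N²⁺ a∈A b∈Na c∈Nb c∈C , a∈A)

    pair : ∀ {b b′} → b ∈ B → b′ ∈ B → Nonempty (X b ∩ X b′) → ∣ S b ∪ S b′ ∣ ≤ℕ M
    pair {b} {b′} _ _ (c , c∈) =
      let (c∈X , c∈X′) = x∈p∩q⁻ (X b) (X b′) c∈ in
      ℕₚ.≤-trans (p⊆q⇒∣p∣≤∣q∣ (λ a∈ → case x∈p∪q⁻ (S b) (S b′) a∈ of λ where
                    (inj₁ a∈S)  → S⊆ c∈X a∈S
                    (inj₂ a∈S′) → S⊆ c∈X′ a∈S′))
                 (v-max c (proj₂ (x∈p∩q⁻ (N b) C c∈X)))

    e-B≡ : e B ≡ n * ∣ A ∣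
    e-B≡ = begin
      e B                      ≡⟨ e-B (λ a b∈W → proj₂ (proj₂ (∈W⁻ b∈W))) ⟩
      sum (λ a → ∣ W a ∣)      ≡⟨ sum-cong-≗ ∣W∣ ⟩
      sum (λ a → n * χ A a)    ≡⟨ sym (*-distribˡ-sum n (χ A)) ⟩
      n * sum (χ A)            ≡⟨ cong (n *_) (sym (∣∣-sum A)) ⟩
      n * ∣ A ∣                ∎
      where open ≡-Reasoning

    large-N²A : ∀ {q} → r ≡ suc q → (r + suc r) * ∣ A ∣ ≤ℕ denominator r * M
    large-N²A {q} refl with star-partition pair (suc ∣ B ∣) B C ℕₚ.≤-refl (λ b∈ → b∈) (λ {b} _ → p∩q⊆q (N b) C)
    ... | ds , sum≤ , len≤ , e≤ = ℕₚ.*-cancelˡ-≤ n {{>-nonZero 0<n}} (begin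
      n * ((r + suc r) * ∣ A ∣)            ≡⟨ x∙yz≈y∙xz n (r + suc r) (∣ A ∣) ⟩
      (r + suc r) * (n * ∣ A ∣)            ≡⟨ cong ((r + suc r) *_) (sym e-B≡) ⟩
      (r + suc r) * e B                    ≤⟨ e≤ ⟩
      sumᴸ (map (cost r n) ds) * M         ≤⟨ ℕₚ.*-monoˡ-≤ M (Σcost-bound q n ds
                                                -- From `length ds * y₀ ≤ ∣ C ∣` and
                                                -- `∣ C ∣ < k * y₀` there are at most k - 1 stars;
                                                -- the strictness of y > 1/k is used here.
                                                (ℕₚ.≤-pred (ℕₚ.*-cancelʳ-< y₀ _ _ (ℕₚ.≤-<-trans len≤ ∣C∣<ky₀)))
                                                (ℕₚ.≤-trans sum≤ ∣B∣≤kn)) ⟩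
      denominator r * n * M                ≡⟨ regroup (denominator r) n M ⟩
      n * (denominator r * M)              ∎)
      where
      open ℕₚ.≤-Reasoning
      regroup : ∀ x y z → x * y * z ≡ y * (x * z)
      regroup = solve-∀

    best-c = max-on C (λ c → ∣ N c ∩ B ∣) C-nonempty

    -- Otherwise every vertex of `C` has at most `∣ B ∣ / k` neighbours in `B`, and double counting
    -- the edges between `B` and `C` gives `k * y₀ ≤ ∣ C ∣`, contrary to `∣C∣<ky₀`.
    popular : ∣ B ∣ <ℕ suc (suc r) * ∣ N (proj₁ best-c) ∩ B ∣
    popular = ℕₚ.≰⇒> λ kμ≤B → ℕₚ.<⇒≱ ∣C∣<ky₀ (ℕₚ.*-cancelˡ-≤ (∣ B ∣) {{>-nonZero 0<B}} (begin
      ∣ B ∣ * (suc (suc r) * y₀)     ≡⟨ x∙yz≈y∙xz (∣ B ∣) (suc (suc r)) y₀ ⟩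
      suc (suc r) * (∣ B ∣ * y₀)     ≤⟨ ℕₚ.*-monoʳ-≤ (suc (suc r)) (double-count B C N N N-sym y₀ μ
                                          (proj₂ (proj₂ best-b)) (proj₂ (proj₂ best-c))) ⟩
      suc (suc r) * (∣ C ∣ * μ)      ≡⟨ x∙yz≈y∙xz (suc (suc r)) (∣ C ∣) μ ⟩
      ∣ C ∣ * (suc (suc r) * μ)      ≤⟨ ℕₚ.*-monoʳ-≤ (∣ C ∣) kμ≤B ⟩
      ∣ C ∣ * ∣ B ∣                  ≡⟨ ℕₚ.*-comm (∣ C ∣) (∣ B ∣) ⟩
      ∣ B ∣ * ∣ C ∣                  ∎))
      where
      open ℕₚ.≤-Reasoning
      μ = ∣ N (proj₁ best-c) ∩ B ∣
      N-sym : ∀ i j → lookup (N i) j ≡ lookup (N j) i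
      N-sym i j with lookup (N i) j in p | lookup (N j) i in q
      ... | true  | true  = refl
      ... | false | false = refl
      ... | true  | false = trans (sym ([]=⇒lookup (symmetric (lookup⇒[]= j (N i) p)))) q
      ... | false | true  = trans (sym p) ([]=⇒lookup (symmetric (lookup⇒[]= i (N j) q)))

    -- For k = 2 each `a ∈ A` is adjacent to at least half of `B` and the vertex of `popular` to
    -- more than half, so they have a common neighbour in `B`.
    all-A : r ≡ 0 → ∣ A ∣ ≤ℕ M
    all-A refl = ℕₚ.≤-trans (p⊆q⇒∣p∣≤∣q∣ A⊆) (v-max c (proj₁ (proj₂ best-c)))
      where
      c = proj₁ best-c
      meet : ∀ {a} → a ∈ A → 0 <ℕ ∣ (N a ∩ B) ∩ (N c ∩ B) ∣
      meet {a} a∈A = ℕₚ.≰⇒> λ i≤0 → ℕₚ.<-irrefl refl (begin-strict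
        2 * ∣ B ∣                                              ≡⟨ double (∣ B ∣) ⟩
        ∣ B ∣ + ∣ B ∣                                          <⟨ ℕₚ.+-mono-≤-< (A-to-B a∈A) popular ⟩
        2 * ∣ N a ∩ B ∣ + 2 * ∣ N c ∩ B ∣                      ≡⟨ sym (ℕₚ.*-distribˡ-+ 2 (∣ N a ∩ B ∣) _) ⟩
        2 * (∣ N a ∩ B ∣ + ∣ N c ∩ B ∣)                        ≡⟨ cong (2 *_) (sym (∣∪∣+∣∩∣ (N a ∩ B) (N c ∩ B))) ⟩
        2 * (∣ (N a ∩ B) ∪ (N c ∩ B) ∣ + ∣ (N a ∩ B) ∩ (N c ∩ B) ∣)
                                                               ≤⟨ ℕₚ.*-monoʳ-≤ 2 (ℕₚ.+-mono-≤ (p⊆q⇒∣p∣≤∣q∣ ∪⊆B) i≤0) ⟩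
        2 * (∣ B ∣ + 0)                                        ≡⟨ cong (2 *_) (ℕₚ.+-identityʳ (∣ B ∣)) ⟩
        2 * ∣ B ∣                                              ∎)
        where
        open ℕₚ.≤-Reasoning
        double : ∀ x → 2 * x ≡ x + x
        double = solve-∀
        ∪⊆B : (N a ∩ B) ∪ (N c ∩ B) ⊆ B
        ∪⊆B x∈ = case x∈p∪q⁻ (N a ∩ B) (N c ∩ B) x∈ of λ where
          (inj₁ x∈) → p∩q⊆q (N a) B x∈
          (inj₂ x∈) → p∩q⊆q (N c) B x∈
      A⊆ : A ⊆ N²A c
      A⊆ {a} a∈A =
        let (b , b∈) = size⇒nonempty _ (meet a∈A)
            (b∈₁ , b∈₂) = x∈p∩q⁻ (N a ∩ B) (N c ∩ B) b∈
        in x∈p∩q⁺ (∈N²⁺ a∈A (p∩q⊆p (N a) B b∈₁) (symmetric (p∩q⊆p (N c) B b∈₂)) (proj₁ (proj₂ best-c)) , a∈A)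

    counting : ∃[ v ] (v ∈ C × (r + suc r) * ∣ A ∣ ≤ℕ denominator r * ∣ N²A v ∣)
    counting = v , v∈C , by-cases r refl
      where
      by-cases : ∀ q → r ≡ q → (r + suc r) * ∣ A ∣ ≤ℕ denominator r * M
      -- For r = 0 both `r + suc r` and `denominator r` are 1.
      by-cases zero    refl = ℕₚ.*-monoʳ-≤ 1 (all-A refl)
      by-cases (suc q) eq   = large-N²A eq

-- From natural numbers to cuts

-- `_/_` reduces to lowest terms, so the identity is verified on unnormalised rationals.
/-*-cancel : ∀ i d .{{_ : NonZero d}} → (i / d) ℚ.* ℕ→ℚ d ≡ i / 1
/-*-cancel i d@(suc d-1) = ℚₚ.toℚᵘ-injective (begin
  ℚ.toℚᵘ ((i / d) ℚ.* ℕ→ℚ d)                ≈⟨ ℚₚ.toℚᵘ-homo-* (i / d) (ℕ→ℚ d) ⟩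
  ℚ.toℚᵘ (i / d) ℚᵘ.* ℚᵘ.mkℚᵘ (+ d) 0       ≈⟨ ℚᵘₚ.*-congʳ (ℚₚ.toℚᵘ-fromℚᵘ (ℚᵘ.mkℚᵘ i d-1)) ⟩
  ℚᵘ.mkℚᵘ i d-1 ℚᵘ.* ℚᵘ.mkℚᵘ (+ d) 0        ≈⟨ ℚᵘ.*≡* (trans (ℤₚ.*-assoc i (+ d) (+ 1)) (cong (i ℤ.*_) (sym (ℤₚ.pos-* d 1)))) ⟩
  ℚᵘ.mkℚᵘ i 0                               ≈⟨ ℚᵘₚ.≃-sym (ℚₚ.toℚᵘ-fromℚᵘ (ℚᵘ.mkℚᵘ i 0)) ⟩
  ℚ.toℚᵘ (i / 1)                            ∎)
  where open ℚᵘₚ.≃-Reasoning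

ℕ→ℚ≡/1 : ∀ n → + n / 1 ≡ ℕ→ℚ n
ℕ→ℚ≡/1 n = ℚₚ.fromℚᵘ-toℚᵘ (ℕ→ℚ n)

fraction-* : ∀ a d .{{_ : NonZero d}} → (+ a / d) ℚ.* ℕ→ℚ d ≡ ℕ→ℚ a
fraction-* a d = trans (/-*-cancel (+ a) d) (ℕ→ℚ≡/1 a)

ℕ→ℚ-cancel-≤ : ∀ {m n} → ℕ→ℚ m ℚ.≤ ℕ→ℚ n → m ≤ℕ n
ℕ→ℚ-cancel-≤ {m} {n} h = ℤₚ.drop‿+≤+ (ℤₚ.*-cancelʳ-≤-pos (+ m) (+ n) (+ 1) (ℚₚ.drop-*≤* h))

ℕ→ℚ-mono-< : ∀ {m n} → m <ℕ n → ℕ→ℚ m ℚ.< ℕ→ℚ n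
ℕ→ℚ-mono-< m<n = ℚₚ.≰⇒> (λ n≤m → ℕₚ.<⇒≱ m<n (ℕ→ℚ-cancel-≤ n≤m))

ℕ→ℚ-cancel-< : ∀ {m n} → ℕ→ℚ m ℚ.< ℕ→ℚ n → m <ℕ n
ℕ→ℚ-cancel-< m<n = ℕₚ.≰⇒> (λ n≤m → ℚₚ.<-irrefl refl (ℚₚ.<-≤-trans m<n (ℕ→ℚ-mono n≤m)))

-- The cut of `p` does not contain `p`, so `·≤⇒*≤` cannot be used at `p` itself. If the claim
-- failed, a rational strictly between `m / n` and `p` would lie in the cut and contradict `·≤⇒*≤`
-- there.
fromℚ·≤⇒*≤ : ∀ p n m .{{_ : NonZero n}} → fromℚ p · n ≤ fromℕ m → p ℚ.* ℕ→ℚ n ℚ.≤ ℕ→ℚ m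
fromℚ·≤⇒*≤ p n@(suc _) m h = ℚₚ.≮⇒≥ λ m<pn →
  let q = + m / n
      qn≡m = fraction-* m n
      q<p = ℚₚ.*-cancelʳ-<-nonNeg (ℕ→ℚ n) (subst (ℚ._< p ℚ.* ℕ→ℚ n) (sym qn≡m) m<pn)
      (s , q<s , s<p) = ℚₚ.<-dense q<p
  in ℚₚ.<-irrefl refl (ℚₚ.<-≤-trans q<s (ℚₚ.*-cancelʳ-≤-pos {p = s} {q = q} (ℕ→ℚ n)
       (subst (s ℚ.* ℕ→ℚ n ℚ.≤_) (sym qn≡m) (·≤⇒*≤ (fromℚ p) s n m s<p h))))

1/k-*-* : ∀ k n .{{_ : NonZero k}} → (+ 1 / k) ℚ.* ℕ→ℚ n ℚ.* ℕ→ℚ k ≡ ℕ→ℚ n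
1/k-*-* k n = begin
  p ℚ.* ℕ→ℚ n ℚ.* ℕ→ℚ k      ≡⟨ ℚₚ.*-assoc p _ _ ⟩
  p ℚ.* (ℕ→ℚ n ℚ.* ℕ→ℚ k)    ≡⟨ cong (p ℚ.*_) (ℚₚ.*-comm (ℕ→ℚ n) (ℕ→ℚ k)) ⟩
  p ℚ.* (ℕ→ℚ k ℚ.* ℕ→ℚ n)    ≡⟨ sym (ℚₚ.*-assoc p _ _) ⟩
  p ℚ.* ℕ→ℚ k ℚ.* ℕ→ℚ n      ≡⟨ cong (ℚ._* ℕ→ℚ n) (fraction-* 1 k) ⟩
  1ℚ ℚ.* ℕ→ℚ n               ≡⟨ ℚₚ.*-identityˡ _ ⟩
  ℕ→ℚ n                      ∎
  where
  open ≡-Reasoning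
  p = + 1 / k

1/k·≤⇒≤* : ∀ k n m .{{_ : NonZero k}} .{{_ : NonZero n}} → fromℚ (+ 1 / k) · n ≤ fromℕ m → n ≤ℕ k * m
1/k·≤⇒≤* k n m h = ℕ→ℚ-cancel-≤ (begin
  ℕ→ℚ n                                 ≡⟨ sym (1/k-*-* k n) ⟩
  (+ 1 / k) ℚ.* ℕ→ℚ n ℚ.* ℕ→ℚ k         ≤⟨ ℚₚ.*-monoʳ-≤-nonNeg (ℕ→ℚ k) (fromℚ·≤⇒*≤ (+ 1 / k) n m h) ⟩
  ℕ→ℚ m ℚ.* ℕ→ℚ k                       ≡⟨ sym (ℕ→ℚ-* m k) ⟩
  ℕ→ℚ (m * k)                           ≡⟨ cong ℕ→ℚ (ℕₚ.*-comm m k) ⟩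
  ℕ→ℚ (k * m)                           ∎)
  where open ℚₚ.≤-Reasoning

-- The witness of 1/k < y is only known to be at least 1/k. Roundedness of `y` provides a member
-- strictly above it, whence the strict inequality of naturals.
y·≤⇒<* : ∀ k n m y .{{_ : NonZero k}} .{{_ : NonZero n}} → fromℚ (+ 1 / k) < y →
         y · n ≤ fromℕ m → n <ℕ k * m
y·≤⇒<* k@(suc _) n@(suc _) m y (q , q∈y , q≮p) h with rounded y q∈y
... | r , q<r , r∈y = ℕ→ℚ-cancel-< (begin-strict
  ℕ→ℚ n                                 ≡⟨ sym (1/k-*-* k n) ⟩
  (+ 1 / k) ℚ.* ℕ→ℚ n ℚ.* ℕ→ℚ k         <⟨ ℚₚ.*-monoˡ-<-pos (ℕ→ℚ k) (ℚₚ.*-monoˡ-<-pos (ℕ→ℚ n) (ℚₚ.≤-<-trans (ℚₚ.≮⇒≥ q≮p) q<r)) ⟩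
  r ℚ.* ℕ→ℚ n ℚ.* ℕ→ℚ k                 ≤⟨ ℚₚ.*-monoʳ-≤-nonNeg (ℕ→ℚ k) (·≤⇒*≤ y r n m r∈y h) ⟩
  ℕ→ℚ m ℚ.* ℕ→ℚ k                       ≡⟨ sym (ℕ→ℚ-* m k) ⟩
  ℕ→ℚ (m * k)                           ≡⟨ cong ℕ→ℚ (ℕₚ.*-comm m k) ⟩
  ℕ→ℚ (k * m)                           ∎)
  where open ℚₚ.≤-Reasoning

fraction-*-≤ : ∀ a d n m .{{_ : NonZero d}} → a * n ≤ℕ d * m → (+ a / d) ℚ.* ℕ→ℚ n ℚ.≤ ℕ→ℚ m
fraction-*-≤ a d n m h = average (+ a / d) n d a m
  (subst (_≤ℕ d * m) (ℕₚ.*-comm a n) h) (ℚₚ.≤-reflexive (fraction-* a d))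

fraction-inUnit : ∀ a d .{{_ : NonZero a}} .{{_ : NonZero d}} → a ≤ℕ d → InUnit (fromℚ (+ a / d))
fraction-inUnit a@(suc _) d a≤d = (0ℚ , 0<z , ℚₚ.<-irrefl refl) , λ q q<z → ℚₚ.<-≤-trans q<z z≤1
  where
  z = + a / d
  0<z : 0ℚ ℚ.< z
  0<z = ℚₚ.*-cancelʳ-<-nonNeg (ℕ→ℚ d) (subst₂ ℚ._<_ (sym (ℚₚ.*-zeroˡ (ℕ→ℚ d))) (sym (fraction-* a d))
          (ℕ→ℚ-mono-< {0} (s≤s z≤n)))
  z≤1 : z ℚ.≤ 1ℚ
  z≤1 = subst (ℚ._≤ 1ℚ) (ℚₚ.*-identityʳ z)
    (fraction-*-≤ a d 1 1 (subst₂ _≤ℕ_ (sym (ℕₚ.*-identityʳ a)) (sym (ℕₚ.*-identityʳ d)) a≤d))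

-- The truncated difference loses nothing and the integer one is nonnegative: 2k = 3 + (2r + 1) and
-- 2k² = (2r² + 4r) + 4k.
bound≡ : ∀ r → let k = suc (suc r) in
  (2 * k ⊖ 3) / suc (2 * k ^ 2 ∸ 4 * k) ≡ + (r + suc r) / denominator r
bound≡ r = ℚₚ./-cong numerators (cong suc denominators)
  where
  k = suc (suc r)
  num : ∀ r → 2 * suc (suc r) ≡ 3 + (r + suc r)
  num = solve-∀
  numerators : 2 * k ⊖ 3 ≡ + (r + suc r)
  numerators = trans (cong (_⊖ 3) (num r)) (ℤₚ.⊖-≥ (ℕₚ.m≤m+n 3 (r + suc r)))
  den : ∀ r → 2 * (suc (suc r) * (suc (suc r) * 1)) ≡ 2 * (r * r) + 4 * r + 4 * suc (suc r)
  den = solve-∀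
  denominators : 2 * k ^ 2 ∸ 4 * k ≡ 2 * (r * r) + 4 * r
  denominators = trans (cong (_∸ 4 * k) (den r)) (ℕₚ.m+n∸n≡m (2 * (r * r) + 4 * r) (4 * k))

mainTheorem2 : (k : ℕ) .{{_ : NonZero k}} → 2 ≤ℕ k →
    (y : ℝ) → InUnit y → fromℚ (+ 1 / k) < y →
    fromℚ ((2 * k ⊖ 3) / suc (2 * k ^ 2 ∸ 4 * k)) ≤ φ (fromℚ (+ 1 / k)) y
mainTheorem2 1 (s≤s ())
-- `φ` is an upper bound of the admissible reals, so admissibility of the fraction suffices.
mainTheorem2 (suc (suc r)) _ y y∈ x<y = subst (λ z → fromℚ z ≤ φ x y) (sym (bound≡ r))
  (proj₂ (φ-isMaximum x y (fraction-inUnit 1 k (s≤s z≤n)) y∈) (fromℚ z) admissible)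
  where
  k = suc (suc r)
  x = fromℚ (+ 1 / k)
  z = + (r + suc r) / denominator r

  numerator≤denominator : r + suc r ≤ℕ denominator r
  numerator≤denominator = ℕₚ.≤-trans (ℕₚ.m≤m+n (r + suc r) (2 * (r * r) + 2 * r)) (ℕₚ.≤-reflexive (identity r))
    where
    identity : ∀ r → r + suc r + (2 * (r * r) + 2 * r) ≡ suc (2 * (r * r) + 4 * r)
    identity = solve-∀

  admissible : Admissible x y (fromℚ z)
  admissible = fraction-inUnit (r + suc r) (denominator r) {{>-nonZero (ℕₚ.m≤n⇒m≤o+n r (s≤s z≤n))}} numerator≤denominator
    , λ G T K → let
        open Tripartition T
        open Constrained K
        -- The strict bound obtained from `B-to-C` would fail for `∣ C ∣ = 0`; nonemptiness supplies
        -- the instances that both conversions require.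
        instance
          _ = nonempty⇒size B-nonempty
          _ = nonempty⇒size C-nonempty
        (v , v∈C , h) = Counting.counting r G T A-to-C
          (λ {a} a∈A → 1/k·≤⇒≤* k (∣ B ∣) _ (A-to-B a∈A))
          (λ {b} b∈B → y·≤⇒<* k (∣ C ∣) _ y x<y (B-to-C b∈B))
      in v , v∈C , *≤⇒·≤ z (∣ A ∣) (∣ N²A v ∣) (fraction-*-≤ (r + suc r) (denominator r) (∣ A ∣) (∣ N²A v ∣) h)
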